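{- Let $(\mathcal{L}_n(x))_{n\ge 0}$ be a Lucas-type polynomial sequence determined by $p_0$, $p_1(x)$, $d(x)=\alpha p_1(x)$ and $g(x)$. Let $q$ be a prime number with $q\equiv 3\pmod 4$. If $g(x)=-q\,h(x)^2$ for some $h(x)\in\mathbb{Z}[x]$, then $\mathcal{L}_q(x)/p_1(x)$ is reducible over $\mathbb{Q}$.
   Context: A Lucas-type polynomial sequence is determined by an integer $p_0$ with $|p_0|\in\{1,2\}$ and non-zero polynomials $p_1(x),g(x)\in\mathbb{Z}[x]$; put $\alpha=2/p_0\in\mathbb{Z}$ and $d(x)=\alpha p_1(x)$. Then $\mathcal{L}_0(x)=p_0$, $\mathcal{L}_1(x)=p_1(x)$, and $\mathcal{L}_n(x)=d(x)\mathcal{L}_{n-1}(x)+g(x)\mathcal{L}_{n-2}(x)$ for $n\ge 2$. Standing assumptions: $\gcd(d(x),g(x))=1$, $\deg(g)<\deg(d)$, $\gcd(p_0,p_1(x))=\gcd(p_0,d(x))=\gcd(p_0,g(x))=1$, and $\deg(p_1)\ge 1$, where $\gcd=1$ means that the only common divisors in $\mathbb{Z}[x]$ are $\pm 1$. "Reducible over $\mathbb{Q}$" means being a product of two non-constant polynomials in $\mathbb{Q}[x]$. -}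

module Defs where

open import Algebra.Bundles using (RawRing)
open import Data.Integer.Base as ℤ using (ℤ; +_)
open import Data.List.Base as List using (List; []; _∷_)
open import Data.Nat.Base as ℕ using (ℕ; zero; suc)
open import Data.Product.Base using (∃; ∃₂; _×_)
open import Data.Rational.Base as ℚ using (ℚ)
open import Data.Sum.Base using (_⊎_)
open import Level using (_⊔_)
open import Relation.Binary.PropositionalEquality.Core using (_≡_)
open import Relation.Nullary.Negation.Core using (¬_)

import Algebra.Definitions.RawMagma as RawMagmaDefinitions

-- Univariate polynomials over R.  A polynomial is a list of coefficients,
-- constant term first; trailing zeros are allowed, so the equality of R[x]
-- is _≈_ and not _≡_.
module Polynomial {c ℓ} (R : RawRing c ℓ) where

  private module R = RawRing R

  Poly : Set c
  Poly = List R.Carrier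

  coeff : Poly → ℕ → R.Carrier
  coeff []      _       = R.0#
  coeff (a ∷ p) zero    = a
  coeff (a ∷ p) (suc n) = coeff p n

  infix  4 _≈_
  infixl 6 _+_
  infixl 7 _*_ _·_
  infix  8 -_

  -- A record rather than a bare Π-type, so that p and q can be inferred
  -- from a proof of p ≈ q.
  record _≈_ (p q : Poly) : Set ℓ where
    constructor mk≈
    field
      coeff-≈ : ∀ n → coeff p n R.≈ coeff q n

  const : R.Carrier → Poly
  const a = a ∷ []

  _+_ : Poly → Poly → Poly
  []      + q       = q
  (a ∷ p) + []      = a ∷ p
  (a ∷ p) + (b ∷ q) = (a R.+ b) ∷ (p + q)

  _·_ : R.Carrier → Poly → Poly
  a · p = List.map (a R.*_) p

  -_ : Poly → Poly
  - p = List.map R.-_ p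

  _*_ : Poly → Poly → Poly
  []      * q = []
  (a ∷ p) * q = (a · q) + (R.0# ∷ (p * q))

  rawRing : RawRing c ℓ
  rawRing = record
    { Carrier = Poly
    ; _≈_     = _≈_
    ; _+_     = _+_
    ; _*_     = _*_
    ; -_      = -_
    ; 0#      = []
    ; 1#      = const R.1#
    }

  open RawRing rawRing public using (_≉_; 0#; 1#)
  open RawMagmaDefinitions (RawRing.*-rawMagma rawRing) public using (_∣_)

  -- The zero polynomial has no degree.
  HasDegree : Poly → ℕ → Set ℓ
  HasDegree p n = ¬ (coeff p n R.≈ R.0#) × (∀ m → n ℕ.< m → coeff p m R.≈ R.0#)

  NonConstant : Poly → Set ℓ
  NonConstant p = ∃ λ n → HasDegree p n × 1 ℕ.≤ n

  infix 4 _deg<_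

  _deg<_ : Poly → Poly → Set ℓ
  p deg< q = ∃₂ λ m n → HasDegree p m × HasDegree q n × m ℕ.< n

  OnlyTrivialCommonDivisors : Poly → Poly → Set (c ⊔ ℓ)
  OnlyTrivialCommonDivisors p q = ∀ e → e ∣ p → e ∣ q → e ≈ 1# ⊎ e ≈ - 1#

  Reducible : Poly → Set (c ⊔ ℓ)
  Reducible p = ∃₂ λ u v → NonConstant u × NonConstant v × p ≈ u * v

module ℤ[x] = Polynomial ℤ.+-*-rawRing
module ℚ[x] = Polynomial ℚ.+-*-rawRing

toℚ[x] : ℤ[x].Poly → ℚ[x].Poly
toℚ[x] = List.map (λ a → a ℚ./ 1)

record LucasType : Set where
  open ℤ[x]
  field
    p₀ : ℤ
    p₁ : Poly
    g  : Poly
    -- α = 2 / p₀, determined by the equation α-def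
    α  : ℤ

    ∣p₀∣∈｛1,2｝ : ℤ.∣ p₀ ∣ ≡ 1 ⊎ ℤ.∣ p₀ ∣ ≡ 2
    α-def       : α ℤ.* p₀ ≡ + 2
    p₁≉0        : p₁ ≉ 0#
    g≉0         : g ≉ 0#

  d : Poly
  d = α · p₁

  field
    gcd[d,g]≡1   : OnlyTrivialCommonDivisors d g
    g-deg<-d     : g deg< d
    gcd[p₀,p₁]≡1 : OnlyTrivialCommonDivisors (const p₀) p₁
    gcd[p₀,d]≡1  : OnlyTrivialCommonDivisors (const p₀) d
    gcd[p₀,g]≡1  : OnlyTrivialCommonDivisors (const p₀) g
    1≤deg-p₁     : NonConstant p₁

  ℒ : ℕ → Poly
  ℒ zero          = const p₀
  ℒ (suc zero)    = p₁
  ℒ (suc (suc n)) = d * ℒ (suc n) + g * ℒ n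

module Submission where

-- Write q = 2m + 1 and ℒ_q = p₁ V(d, h): here V(t, 1) is the even polynomial
-- V_m(t), where t V_j(t) = a²ʲ⁺¹ + b²ʲ⁺¹ for a + b = t and a b = q, so it suffices
-- to factor V_m over ℚ and to homogenize the factors.  Modulo V_m the quotient
-- ζ = - a / b is a primitive q-th root of unity, whence, with k running over the
-- odd numbers below q,
--   ∏ (aᵏ + bᵏ)² = ∏ (1 - ζᵏ)(1 - ζ⁻ᵏ) qᵏ = q ⋅ q^(m²).
-- As q ≡ 3 (mod 4), m is odd and this is the square of an integer C; so V_m divides
-- (w - C)(w + C), where w = ∏ (aᵏ + bᵏ) is an odd polynomial in t.  If V_m divided
-- one of the factors, then substituting - t for t it would divide the other one,
-- hence also 2C.  So gcd(V_m, w - C) is a proper factor of V_m.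

-- The obstacle is that ζ does not live in a field: the modulus V_m is about to be shown reducible,
-- so the ring of polynomials in t modulo V_m has zero divisors, and adjoining a does not remove
-- them. Factoring 1 + x + ... + x^(q-1) over the powers of ζ therefore asks for more than distinct
-- roots: their differences must not be zero divisors. This holds because each difference is a unit
-- times some 1 - ζᵉ with e prime to q, some multiple of 1 - ζᵉ is a unit times 1 - ζ, and 1 - ζ
-- divides q, which is invertible. Only odd k occur because the sign in ζ = - a / b turns 1 - ζᵏ
-- into (aᵏ + bᵏ) / bᵏ just for odd k. The roots with even exponents are still all counted: they are
-- the inverses of those with odd exponents, as q - k is even. The parity argument needs a single
-- variable t, so V_m is factored before h enters. Homogenizing then keeps the factors non-constant
-- because deg h < deg d.

open import Defs
open import Algebra.Bundles using (CommutativeRing)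
open import Algebra.Morphism.Structures using (module RingMorphisms)
open import Algebra.Solver.Ring.AlmostCommutativeRing
  using (fromCommutativeRing; _-Raw-AlmostCommutative⟶_)
open import Data.Integer.Base as ℤ using (ℤ; +_; -[1+_]; _⊖_; _◃_)
import Data.Integer.Properties as ℤ
open import Data.List.Base as List using (List; []; _∷_; length; replicate)
open import Data.List.Properties using (length-replicate)
open import Data.List.Relation.Unary.All as All using (All; []; _∷_)
open import Data.List.Relation.Unary.AllPairs using (AllPairs; []; _∷_)
open import Data.Maybe.Base using (Maybe; map)
open import Data.Nat.Base as ℕ using (ℕ; zero; suc; z≤n; s≤s; _%_; _/_)
import Data.Nat.Properties as ℕ
open import Data.Nat.Coprimality as Coprime using (Coprime; prime⇒coprime)
open import Data.Nat.DivMod using (m≡m%n+[m/n]*n)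
open import Data.Nat.Divisibility using (_∣_; ∣⇒≤)
open import Data.Nat.GCD using (module Bézout)
open import Data.Nat.Primality using (Prime; prime⇒irreducible; euclidsLemma)
import Data.Nat.Solver
open import Data.Product.Base using (∃; ∃₂; _×_; _,_; proj₁; proj₂)
open import Data.Rational.Base as ℚ using (ℚ; mkℚ)
import Data.Rational.Properties as ℚ
import Data.Sign.Base as Sign
open import Data.Sum.Base using (_⊎_; inj₁; inj₂)
open import Level using (_⊔_)
open import Relation.Binary.Bundles using (Setoid)
open import Relation.Binary.Consequences using (dec⇒weaklyDec)
open import Relation.Binary.Definitions using (tri<; tri≈; tri>)
open import Relation.Binary.PropositionalEquality.Core as ≡ using (_≡_)
open import Relation.Binary.Structures using (IsEquivalence)
open import Relation.Nullary.Decidable using (yes; no)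
open import Relation.Nullary.Negation.Core using (¬_; contradiction)
import Algebra.Properties.AbelianGroup
import Algebra.Properties.CommutativeSemiring.Exp
import Algebra.Properties.Group
import Algebra.Properties.Ring
import Algebra.Properties.Semiring.Exp
import Algebra.Properties.Semiring.Mult
import Algebra.Solver.Ring
import Relation.Binary.Reasoning.Setoid

-- The ring solvers of the library need a decidable coefficient equality in
-- order to cancel terms, which an abstract ring does not have; so the
-- coefficients are integers.
module IntegerSolver {c ℓ} (R : CommutativeRing c ℓ) where
  open CommutativeRing R
  open Algebra.Properties.Ring ring using (-‿distribˡ-*; -‿distribʳ-*)
  open Algebra.Properties.AbelianGroup +-abelianGroup using (⁻¹-∙-comm; ⁻¹-involutive; ε⁻¹≈ε)
  open Algebra.Properties.Semiring.Mult semiring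
    using (×-homo-+; ×1-homo-*) renaming (_×_ to _×′_)
  open Relation.Binary.Reasoning.Setoid setoid

  private
    -- The clause for 1 makes the constant :1 denote 1# definitionally.
    ⟦_⟧ : ℤ → Carrier
    ⟦ + 1 ⟧      = 1#
    ⟦ + n ⟧      = n ×′ 1#
    ⟦ -[1+ n ] ⟧ = - (suc n ×′ 1#)

    ⟦+⟧ : ∀ n → ⟦ + n ⟧ ≈ n ×′ 1#
    ⟦+⟧ 0             = refl
    ⟦+⟧ 1             = sym (+-identityʳ 1#)
    ⟦+⟧ (suc (suc n)) = refl

    ⟦⊖⟧ : ∀ m n → ⟦ m ⊖ n ⟧ ≈ m ×′ 1# - n ×′ 1#
    ⟦⊖⟧ m       zero    = trans (⟦+⟧ m) (sym (trans (+-congˡ ε⁻¹≈ε) (+-identityʳ _)))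
    ⟦⊖⟧ zero    (suc n) = sym (+-identityˡ _)
    ⟦⊖⟧ (suc m) (suc n) = begin
      ⟦ suc m ⊖ suc n ⟧                      ≡⟨ ≡.cong ⟦_⟧ (ℤ.[1+m]⊖[1+n]≡m⊖n m n) ⟩
      ⟦ m ⊖ n ⟧                              ≈⟨ ⟦⊖⟧ m n ⟩
      x - y                                  ≈⟨ +-congʳ (+-identityˡ x) ⟨
      0# + x - y                             ≈⟨ +-congʳ (+-congʳ (-‿inverseʳ 1#)) ⟨
      1# - 1# + x - y                        ≈⟨ +-congʳ (trans (+-assoc 1# (- 1#) x) (trans (+-congˡ (+-comm (- 1#) x)) (sym (+-assoc 1# x (- 1#))))) ⟩
      1# + x - 1# - y                        ≈⟨ +-assoc _ _ _ ⟩
      1# + x + (- 1# - y)                    ≈⟨ +-congˡ (⁻¹-∙-comm 1# y) ⟩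
      suc m ×′ 1# - suc n ×′ 1#              ∎
      where
      x = m ×′ 1#
      y = n ×′ 1#

    ⟦◃+⟧ : ∀ n → ⟦ Sign.+ ◃ n ⟧ ≈ n ×′ 1#
    ⟦◃+⟧ zero    = refl
    ⟦◃+⟧ (suc n) = ⟦+⟧ (suc n)

    ⟦◃-⟧ : ∀ n → ⟦ Sign.- ◃ n ⟧ ≈ - (n ×′ 1#)
    ⟦◃-⟧ zero    = sym ε⁻¹≈ε
    ⟦◃-⟧ (suc n) = refl

    +-homo : ∀ i j → ⟦ i ℤ.+ j ⟧ ≈ ⟦ i ⟧ + ⟦ j ⟧
    +-homo (+ m)    (+ n)    = trans (⟦+⟧ (m ℕ.+ n)) (trans (×-homo-+ 1# m n)
      (sym (+-cong (⟦+⟧ m) (⟦+⟧ n))))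
    +-homo (+ m)    -[1+ n ] = trans (⟦⊖⟧ m (suc n)) (+-congʳ (sym (⟦+⟧ m)))
    +-homo -[1+ m ] (+ n)    = trans (⟦⊖⟧ n (suc m)) (trans (+-comm _ _) (+-congˡ (sym (⟦+⟧ n))))
    +-homo -[1+ m ] -[1+ n ] = begin
      - (suc (suc (m ℕ.+ n)) ×′ 1#)     ≡⟨ ≡.cong (λ k → - (suc k ×′ 1#)) (ℕ.+-suc m n) ⟨
      - ((suc m ℕ.+ suc n) ×′ 1#)       ≈⟨ -‿cong (×-homo-+ 1# (suc m) (suc n)) ⟩
      - (suc m ×′ 1# + suc n ×′ 1#)     ≈⟨ ⁻¹-∙-comm _ _ ⟨
      - (suc m ×′ 1#) - suc n ×′ 1#     ∎

    *-homo : ∀ i j → ⟦ i ℤ.* j ⟧ ≈ ⟦ i ⟧ * ⟦ j ⟧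
    *-homo (+ m)    (+ n)    = begin
      ⟦ Sign.+ ◃ m ℕ.* n ⟧         ≈⟨ ⟦◃+⟧ (m ℕ.* n) ⟩
      (m ℕ.* n) ×′ 1#              ≈⟨ ×1-homo-* m n ⟩
      m ×′ 1# * n ×′ 1#            ≈⟨ *-cong (⟦+⟧ m) (⟦+⟧ n) ⟨
      ⟦ + m ⟧ * ⟦ + n ⟧            ∎
    *-homo (+ m)    -[1+ n ] = begin
      ⟦ Sign.- ◃ m ℕ.* suc n ⟧     ≈⟨ ⟦◃-⟧ (m ℕ.* suc n) ⟩
      - ((m ℕ.* suc n) ×′ 1#)      ≈⟨ -‿cong (×1-homo-* m (suc n)) ⟩
      - (m ×′ 1# * suc n ×′ 1#)    ≈⟨ -‿distribʳ-* _ _ ⟩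
      m ×′ 1# * - (suc n ×′ 1#)    ≈⟨ *-congʳ (⟦+⟧ m) ⟨
      ⟦ + m ⟧ * ⟦ -[1+ n ] ⟧       ∎
    *-homo -[1+ m ] (+ n)    = begin
      ⟦ Sign.- ◃ suc m ℕ.* n ⟧     ≈⟨ ⟦◃-⟧ (suc m ℕ.* n) ⟩
      - ((suc m ℕ.* n) ×′ 1#)      ≈⟨ -‿cong (×1-homo-* (suc m) n) ⟩
      - (suc m ×′ 1# * n ×′ 1#)    ≈⟨ -‿distribˡ-* _ _ ⟩
      - (suc m ×′ 1#) * n ×′ 1#    ≈⟨ *-congˡ (⟦+⟧ n) ⟨
      ⟦ -[1+ m ] ⟧ * ⟦ + n ⟧       ∎
    *-homo -[1+ m ] -[1+ n ] = begin
      ⟦ Sign.+ ◃ suc m ℕ.* suc n ⟧         ≈⟨ ⟦◃+⟧ (suc m ℕ.* suc n) ⟩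
      (suc m ℕ.* suc n) ×′ 1#              ≈⟨ ×1-homo-* (suc m) (suc n) ⟩
      suc m ×′ 1# * suc n ×′ 1#            ≈⟨ ⁻¹-involutive _ ⟨
      - - (suc m ×′ 1# * suc n ×′ 1#)      ≈⟨ -‿cong (-‿distribʳ-* _ _) ⟩
      - (suc m ×′ 1# * - (suc n ×′ 1#))    ≈⟨ -‿distribˡ-* _ _ ⟩
      - (suc m ×′ 1#) * - (suc n ×′ 1#)    ∎

    -‿homo : ∀ i → ⟦ ℤ.- i ⟧ ≈ - ⟦ i ⟧
    -‿homo (+ zero)  = sym ε⁻¹≈ε
    -‿homo (+ suc n) = -‿cong (sym (⟦+⟧ (suc n)))
    -‿homo -[1+ n ]  = trans (⟦+⟧ (suc n)) (sym (⁻¹-involutive _))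

    morphism : ℤ.+-*-rawRing -Raw-AlmostCommutative⟶ fromCommutativeRing R
    morphism = record
      { ⟦_⟧ = ⟦_⟧
      ; +-homo = +-homo
      ; *-homo = *-homo
      ; -‿homo = -‿homo
      ; 0-homo = refl
      ; 1-homo = refl
      }

    ⟦⟧-≟ : ∀ i j → Maybe (⟦ i ⟧ ≈ ⟦ j ⟧)
    ⟦⟧-≟ i j = map (λ i≡j → reflexive (≡.cong ⟦_⟧ i≡j)) (dec⇒weaklyDec ℤ._≟_ i j)

  open Algebra.Solver.Ring ℤ.+-*-rawRing (fromCommutativeRing R) morphism ⟦⟧-≟ public
    using (solve; _:=_; _:+_; _:*_; _:-_; :-_)

  private
    open Algebra.Solver.Ring ℤ.+-*-rawRing (fromCommutativeRing R) morphism ⟦⟧-≟ using (con)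
    Term : ℕ → Set _
    Term = Algebra.Solver.Ring.Polynomial ℤ.+-*-rawRing (fromCommutativeRing R) morphism ⟦⟧-≟

  :0 :1 : ∀ {n} → Term n
  :0 = con (+ 0)
  :1 = con (+ 1)

-- The commutative ring of polynomials over a commutative ring.

module PolynomialRing {c ℓ} (R : CommutativeRing c ℓ) where
  private module R = CommutativeRing R
  open Polynomial R.rawRing public
  open IntegerSolver R
  open _≈_ public

  coeff-+ : ∀ p q n → coeff (p + q) n R.≈ coeff p n R.+ coeff q n
  coeff-+ []      q       n       = R.sym (R.+-identityˡ _)
  coeff-+ (a ∷ p) []      n       = R.sym (R.+-identityʳ _)
  coeff-+ (a ∷ p) (b ∷ q) zero    = R.refl
  coeff-+ (a ∷ p) (b ∷ q) (suc n) = coeff-+ p q n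

  coeff-· : ∀ a p n → coeff (a · p) n R.≈ a R.* coeff p n
  coeff-· a []      n       = R.sym (R.zeroʳ a)
  coeff-· a (b ∷ p) zero    = R.refl
  coeff-· a (b ∷ p) (suc n) = coeff-· a p n

  coeff-neg : ∀ p n → coeff (- p) n R.≈ R.- coeff p n
  coeff-neg []      n       = solve 0 (:0 := :- :0) R.refl
  coeff-neg (a ∷ p) zero    = R.refl
  coeff-neg (a ∷ p) (suc n) = coeff-neg p n

  ≈-isEquivalence : IsEquivalence _≈_
  ≈-isEquivalence = record
    { refl  = mk≈ λ n → R.refl
    ; sym   = λ p≈q → mk≈ λ n → R.sym (coeff-≈ p≈q n)
    ; trans = λ p≈q q≈r → mk≈ λ n → R.trans (coeff-≈ p≈q n) (coeff-≈ q≈r n)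
    }
  open IsEquivalence ≈-isEquivalence

  private
    setoid : Setoid _ _
    setoid = record { isEquivalence = ≈-isEquivalence }
  open Relation.Binary.Reasoning.Setoid setoid

  ∷-cong : ∀ {a b p q} → a R.≈ b → p ≈ q → (a ∷ p) ≈ (b ∷ q)
  ∷-cong a≈b p≈q = mk≈ λ { zero → a≈b ; (suc n) → coeff-≈ p≈q n }

  tail-≈ : ∀ {a b p q} → (a ∷ p) ≈ (b ∷ q) → p ≈ q
  tail-≈ e = mk≈ λ n → coeff-≈ e (suc n)

  tail-≈0 : ∀ {a p} → (a ∷ p) ≈ [] → p ≈ []
  tail-≈0 e = mk≈ λ n → coeff-≈ e (suc n)

  0∷0 : ∀ {a} → a R.≈ R.0# → (a ∷ []) ≈ []
  0∷0 a≈0 = mk≈ λ { zero → a≈0 ; (suc n) → R.refl }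

  +-cong : ∀ {p p′ q q′} → p ≈ p′ → q ≈ q′ → p + q ≈ p′ + q′
  +-cong {p} {p′} {q} {q′} e f = mk≈ λ n →
    R.trans (coeff-+ p q n) (R.trans (R.+-cong (coeff-≈ e n) (coeff-≈ f n)) (R.sym (coeff-+ p′ q′ n)))

  +-congˡ : ∀ {p q q′} → q ≈ q′ → p + q ≈ p + q′
  +-congˡ = +-cong refl

  +-assoc : ∀ p q r → (p + q) + r ≈ p + (q + r)
  +-assoc []      q       r       = refl
  +-assoc (a ∷ p) []      r       = refl
  +-assoc (a ∷ p) (b ∷ q) []      = refl
  +-assoc (a ∷ p) (b ∷ q) (c ∷ r) = ∷-cong (R.+-assoc a b c) (+-assoc p q r)

  +-comm : ∀ p q → p + q ≈ q + p
  +-comm []      []      = refl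
  +-comm []      (b ∷ q) = refl
  +-comm (a ∷ p) []      = refl
  +-comm (a ∷ p) (b ∷ q) = ∷-cong (R.+-comm a b) (+-comm p q)

  +-identityʳ : ∀ p → p + [] ≈ p
  +-identityʳ p = +-comm p []

  -‿cong : ∀ {p q} → p ≈ q → - p ≈ - q
  -‿cong {p} {q} e = mk≈ λ n →
    R.trans (coeff-neg p n) (R.trans (R.-‿cong (coeff-≈ e n)) (R.sym (coeff-neg q n)))

  -‿inverseʳ : ∀ p → p + (- p) ≈ []
  -‿inverseʳ p = mk≈ λ n →
    R.trans (coeff-+ p (- p) n) (R.trans (R.+-congˡ (coeff-neg p n)) (R.-‿inverseʳ _))

  ·-cong : ∀ {a b p q} → a R.≈ b → p ≈ q → a · p ≈ b · q
  ·-cong {a} {b} {p} {q} e f = mk≈ λ n →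
    R.trans (coeff-· a p n) (R.trans (R.*-cong e (coeff-≈ f n)) (R.sym (coeff-· b q n)))

  ·-zero : ∀ {a} p → a R.≈ R.0# → a · p ≈ []
  ·-zero {a} p a≈0 = mk≈ λ n → R.trans (coeff-· a p n) (R.trans (R.*-congʳ a≈0) (R.zeroˡ _))

  ·-identity : ∀ p → R.1# · p ≈ p
  ·-identity p = mk≈ λ n → R.trans (coeff-· R.1# p n) (R.*-identityˡ _)

  ·-distribˡ : ∀ a p q → a · (p + q) ≈ a · p + a · q
  ·-distribˡ a []      q       = refl
  ·-distribˡ a (b ∷ p) []      = refl
  ·-distribˡ a (b ∷ p) (c ∷ q) = ∷-cong (R.distribˡ a b c) (·-distribˡ a p q)

  ·-distribʳ : ∀ a b p → (a R.+ b) · p ≈ a · p + b · p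
  ·-distribʳ a b []      = refl
  ·-distribʳ a b (c ∷ p) = ∷-cong (R.distribʳ c a b) (·-distribʳ a b p)

  ·-assoc : ∀ a b p → a · (b · p) ≈ (a R.* b) · p
  ·-assoc a b []      = refl
  ·-assoc a b (c ∷ p) = ∷-cong (R.sym (R.*-assoc a b c)) (·-assoc a b p)

  private
    -- At this point the polynomials are not yet known to form a ring, so the identity is solved
    -- coefficientwise in `R`.
    medial : ∀ p q r s → (p + q) + (r + s) ≈ (p + r) + (q + s)
    medial p q r s = mk≈ λ n → R.trans (expand p q r s n) (R.trans
      (solve 4 (λ a b c d → (a :+ b) :+ (c :+ d) := (a :+ c) :+ (b :+ d)) R.refl
        (coeff p n) (coeff q n) (coeff r n) (coeff s n))
      (R.sym (expand p r q s n)))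
      where
      expand : ∀ p q r s n → coeff ((p + q) + (r + s)) n R.≈
        (coeff p n R.+ coeff q n) R.+ (coeff r n R.+ coeff s n)
      expand p q r s n = R.trans (coeff-+ (p + q) (r + s) n) (R.+-cong (coeff-+ p q n) (coeff-+ r s n))

  shift-+ : ∀ p q → (R.0# ∷ (p + q)) ≈ (R.0# ∷ p) + (R.0# ∷ q)
  shift-+ p q = ∷-cong (R.sym (R.+-identityˡ R.0#)) refl

  shift-· : ∀ a p → (R.0# ∷ (a · p)) ≈ a · (R.0# ∷ p)
  shift-· a p = ∷-cong (R.sym (R.zeroʳ a)) refl

  *-zeroʳ : ∀ p → p * [] ≈ []
  *-zeroʳ []      = refl
  *-zeroʳ (a ∷ p) = trans (∷-cong R.refl (*-zeroʳ p)) (0∷0 R.refl)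

  -- The zero polynomial may be represented by a non-empty list of zeros, hence the induction. It
  -- lets `*-cong` compare lists of different lengths.
  ≈0-* : ∀ {p} q → p ≈ [] → p * q ≈ []
  ≈0-* {[]}    q e = refl
  ≈0-* {a ∷ p} q e = trans
    (+-cong (·-zero q (coeff-≈ e 0)) (∷-cong R.refl (≈0-* {p} q (tail-≈0 e))))
    (0∷0 R.refl)

  *-cong : ∀ {p p′ q q′} → p ≈ p′ → q ≈ q′ → p * q ≈ p′ * q′
  *-cong {[]}    {p′}     {q} {q′} e f = sym (≈0-* q′ (sym e))
  *-cong {a ∷ p} {[]}     {q} {q′} e f = ≈0-* q e
  *-cong {a ∷ p} {b ∷ p′} {q} {q′} e f =
    +-cong (·-cong (coeff-≈ e 0) f) (∷-cong R.refl (*-cong (tail-≈ e) f))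

  *-distribʳ : ∀ r p q → (p + q) * r ≈ p * r + q * r
  *-distribʳ r []      q       = refl
  *-distribʳ r (a ∷ p) []      = sym (+-identityʳ _)
  *-distribʳ r (a ∷ p) (b ∷ q) = begin
    (a R.+ b) · r + (R.0# ∷ ((p + q) * r))
      ≈⟨ +-cong (·-distribʳ a b r) (trans (∷-cong R.refl (*-distribʳ r p q)) (shift-+ (p * r) (q * r))) ⟩
    (a · r + b · r) + ((R.0# ∷ (p * r)) + (R.0# ∷ (q * r)))
      ≈⟨ medial (a · r) (b · r) (R.0# ∷ (p * r)) (R.0# ∷ (q * r)) ⟩
    (a ∷ p) * r + (b ∷ q) * r ∎

  ·-* : ∀ a p q → (a · p) * q ≈ a · (p * q)
  ·-* a []      q = refl
  ·-* a (b ∷ p) q = begin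
    (a R.* b) · q + (R.0# ∷ ((a · p) * q))
      ≈⟨ +-cong (sym (·-assoc a b q)) (trans (∷-cong R.refl (·-* a p q)) (shift-· a (p * q))) ⟩
    a · (b · q) + a · (R.0# ∷ (p * q))     ≈⟨ ·-distribˡ a (b · q) (R.0# ∷ (p * q)) ⟨
    a · ((b ∷ p) * q) ∎

  shift-* : ∀ p q → (R.0# ∷ p) * q ≈ (R.0# ∷ (p * q))
  shift-* p q = +-cong (·-zero q R.refl) refl

  *-assoc : ∀ p q r → (p * q) * r ≈ p * (q * r)
  *-assoc []      q r = refl
  *-assoc (a ∷ p) q r = begin
    (a · q + (R.0# ∷ (p * q))) * r      ≈⟨ *-distribʳ r (a · q) _ ⟩
    (a · q) * r + (R.0# ∷ (p * q)) * r
      ≈⟨ +-cong (·-* a q r) (trans (shift-* (p * q) r) (∷-cong R.refl (*-assoc p q r))) ⟩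
    (a ∷ p) * (q * r) ∎

  -- The mirror image of the recursion that defines `_*_`; commutativity follows from it by
  -- induction.
  *-∷ : ∀ p b q → p * (b ∷ q) ≈ b · p + (R.0# ∷ (p * q))
  *-∷ []      b q = sym (0∷0 R.refl)
  *-∷ (a ∷ p) b q = ∷-cong (R.+-congʳ (R.*-comm a b)) (begin
    a · q + p * (b ∷ q)               ≈⟨ +-congˡ (*-∷ p b q) ⟩
    a · q + (b · p + (R.0# ∷ (p * q)))   ≈⟨ +-assoc (a · q) (b · p) _ ⟨
    (a · q + b · p) + (R.0# ∷ (p * q))   ≈⟨ +-cong (+-comm (a · q) (b · p)) refl ⟩
    (b · p + a · q) + (R.0# ∷ (p * q))   ≈⟨ +-assoc (b · p) (a · q) _ ⟩
    b · p + (a ∷ p) * q               ∎)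

  *-comm : ∀ p q → p * q ≈ q * p
  *-comm []      q = sym (*-zeroʳ q)
  *-comm (a ∷ p) q = trans (+-congˡ (∷-cong R.refl (*-comm p q))) (sym (*-∷ q a p))

  const-* : ∀ a p → const a * p ≈ a · p
  const-* a p = trans (+-congˡ (0∷0 R.refl)) (+-identityʳ (a · p))

  *-identityˡ : ∀ p → 1# * p ≈ p
  *-identityˡ p = trans (const-* R.1# p) (·-identity p)

  commutativeRing : CommutativeRing c ℓ
  commutativeRing = record
    { Carrier = Poly
    ; _≈_ = _≈_
    ; _+_ = _+_
    ; _*_ = _*_
    ; -_  = -_
    ; 0#  = 0#
    ; 1#  = 1#
    ; isCommutativeRing = record
      { isRing = record
        { +-isAbelianGroup = record
          { isGroup = record
            { isMonoid = record
              { isSemigroup = record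
                { isMagma = record { isEquivalence = ≈-isEquivalence ; ∙-cong = +-cong }
                ; assoc = +-assoc
                }
              ; identity = (λ p → refl) , +-identityʳ
              }
            ; inverse = (λ p → trans (+-comm (- p) p) (-‿inverseʳ p)) , -‿inverseʳ
            ; ⁻¹-cong = -‿cong
            }
          ; comm = +-comm
          }
        ; *-cong = *-cong
        ; *-assoc = *-assoc
        ; *-identity = *-identityˡ , λ p → trans (*-comm p 1#) (*-identityˡ p)
        ; distrib = (λ p q r → trans (*-comm p (q + r)) (trans (*-distribʳ p q r)
                      (+-cong (*-comm q p) (*-comm r p))))
                  , *-distribʳ
        }
      ; *-comm = *-comm
      }
    }

  const-cong : ∀ {a b} → a R.≈ b → const a ≈ const b
  const-cong e = ∷-cong e refl

  const-homo-* : ∀ a b → const (a R.* b) ≈ const a * const b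
  const-homo-* a b = sym (const-* a (const b))

  X : Poly
  X = R.0# ∷ R.1# ∷ []

-- Splitting a monic polynomial into linear factors over a ring with zero divisors.

module MonicPolynomials {c ℓ} (R : CommutativeRing c ℓ) where
  open CommutativeRing R
  open IntegerSolver R
  open Relation.Binary.Reasoning.Setoid setoid

  -- Non-zero-divisors. They stand in for non-zero elements, since the ring that contains ζ is not a
  -- domain.
  Cancellable : Carrier → Set _
  Cancellable x = ∀ y → x * y ≈ 0# → y ≈ 0#

  cancellable-cong : ∀ {x y} → x ≈ y → Cancellable x → Cancellable y
  cancellable-cong x≈y cx z yz≈0 = cx z (trans (*-congʳ x≈y) yz≈0)

  cancellable-* : ∀ {x y} → Cancellable x → Cancellable y → Cancellable (x * y)
  cancellable-* cx cy z xyz≈0 = cy z (cx _ (trans (sym (*-assoc _ _ z)) xyz≈0))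

  cancellable-factor : ∀ x y → Cancellable (x * y) → Cancellable x
  cancellable-factor x y cxy z xz≈0 = cxy z (begin
    x * y * z     ≈⟨ solve 3 (λ x y z → x :* y :* z := y :* (x :* z)) refl x y z ⟩
    y * (x * z)   ≈⟨ *-congˡ xz≈0 ⟩
    y * 0#        ≈⟨ zeroʳ y ⟩
    0#            ∎)

  cancellable-neg : ∀ {x} → Cancellable x → Cancellable (- x)
  cancellable-neg {x} cx y -xy≈0 = cx y (begin
    x * y           ≈⟨ solve 2 (λ x y → x :* y := :- (:- x :* y)) refl x y ⟩
    - (- x * y)     ≈⟨ -‿cong -xy≈0 ⟩
    - 0#            ≈⟨ solve 0 (:- :0 := :0) refl ⟩
    0#              ∎)

  cancellable-invertible : ∀ {x} y → x * y ≈ 1# → Cancellable x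
  cancellable-invertible {x} y xy≈1 = cancellable-factor x y
    (λ z e → trans (sym (*-identityˡ z)) (trans (*-congʳ (sym xy≈1)) e))

  -- The leading coefficient 1 is left implicit:  a₀ ∷ … ∷ aₙ₋₁ ∷ []
  -- stands for a₀ + … + aₙ₋₁ xⁿ⁻¹ + xⁿ.
  evalMonic : List Carrier → Carrier → Carrier
  evalMonic []      x = 1#
  evalMonic (a ∷ p) x = a + x * evalMonic p x

  -- Synthetic division by x - r. The quotient is monic again, so its leading 1 stays implicit and
  -- the list becomes one shorter. The value at `[]` is a dummy: the results about `quotient`
  -- concern non-empty lists.
  quotient : List Carrier → Carrier → List Carrier
  quotient []          r = []
  quotient (a ∷ [])    r = []
  quotient (a ∷ b ∷ p) r = evalMonic (b ∷ p) r ∷ quotient (b ∷ p) r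

  length-quotient : ∀ a p r → length (quotient (a ∷ p) r) ≡ length p
  length-quotient a []      r = ≡.refl
  length-quotient a (b ∷ p) r = ≡.cong suc (length-quotient b p r)

  quotient-correct : ∀ a p r x →
    evalMonic (a ∷ p) x ≈ evalMonic (a ∷ p) r + (x - r) * evalMonic (quotient (a ∷ p) r) x
  quotient-correct a [] r x =
    solve 3 (λ a r x → a :+ x :* :1 := a :+ r :* :1 :+ (x :- r) :* :1) refl a r x
  quotient-correct a (b ∷ p) r x = begin
    a + x * evalMonic (b ∷ p) x
      ≈⟨ +-congˡ (*-congˡ (quotient-correct b p r x)) ⟩
    a + x * (evalMonic (b ∷ p) r + (x - r) * evalMonic (quotient (b ∷ p) r) x)
      ≈⟨ solve 5 (λ a r x e q → a :+ x :* (e :+ (x :- r) :* q) := a :+ r :* e :+ (x :- r) :* (e :+ x :* q))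
           refl a r x (evalMonic (b ∷ p) r) (evalMonic (quotient (b ∷ p) r) x) ⟩
    a + r * evalMonic (b ∷ p) r + (x - r) * (evalMonic (b ∷ p) r + x * evalMonic (quotient (b ∷ p) r) x) ∎

  Root : List Carrier → Carrier → Set _
  Root p r = evalMonic p r ≈ 0#

  rootProduct : List Carrier → Carrier → Carrier
  rootProduct []       x = 1#
  rootProduct (r ∷ rs) x = (x - r) * rootProduct rs x

  -- Dividing by x - r leaves a quotient q with (s - r) q(s) = 0 for every other root s. Cancelling
  -- s - r makes s a root of q, and the induction goes on.
  evalMonic≈rootProduct : ∀ p rs → length p ≡ length rs → All (Root p) rs →
    AllPairs (λ r s → Cancellable (s - r)) rs → ∀ x → evalMonic p x ≈ rootProduct rs x
  evalMonic≈rootProduct []      []       _  _           _            x = refl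
  evalMonic≈rootProduct (a ∷ p) (r ∷ rs) eq (pr ∷ prs) (cr ∷ crs) x = begin
    evalMonic (a ∷ p) x                 ≈⟨ divided x ⟩
    (x - r) * evalMonic q x             ≈⟨ *-congˡ (evalMonic≈rootProduct q rs
                                             (≡.trans (length-quotient a p r) (ℕ.suc-injective eq))
                                             (All.zipWith (λ (cs , ps) → cs _ (trans (sym (divided _)) ps)) (cr , prs))
                                             crs x) ⟩
    (x - r) * rootProduct rs x          ∎
    where
    q = quotient (a ∷ p) r
    divided : ∀ y → evalMonic (a ∷ p) y ≈ (y - r) * evalMonic q y
    divided y = trans (quotient-correct a p r y) (trans (+-congʳ pr) (+-identityˡ _))

  evalMonic-cong : ∀ p {x y} → x ≈ y → evalMonic p x ≈ evalMonic p y
  evalMonic-cong []      e = refl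
  evalMonic-cong (a ∷ p) e = +-congˡ (*-cong e (evalMonic-cong p e))

-- Powers of a root ζ of 1 + x + ... + xⁿ.

module RootsOfUnity {c ℓ} (R : CommutativeRing c ℓ) where
  open CommutativeRing R
  open IntegerSolver R
  open MonicPolynomials R
  open Algebra.Properties.Group +-group using (x∙y⁻¹≈ε⇒x≈y)
  open Algebra.Properties.Semiring.Exp semiring public
  open Algebra.Properties.CommutativeSemiring.Exp commutativeSemiring public using (^-distrib-*)
  open Relation.Binary.Reasoning.Setoid setoid

  ones : ℕ → List Carrier
  ones n = replicate n 1#

  -- With the implicit leading 1 this is 1 + x + ... + xⁿ, which has n + 1 terms; at x = 1 it is the
  -- integer n + 1 read in the ring. Below, n + 1 is the prime.
  geometric : ℕ → Carrier → Carrier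
  geometric n = evalMonic (ones n)

  geometric-suc : ∀ n x → geometric (suc n) x ≈ geometric n x + x ^ suc n
  geometric-suc zero    x = refl
  geometric-suc (suc n) x = begin
    1# + x * geometric (suc n) x             ≈⟨ +-congˡ (*-congˡ (geometric-suc n x)) ⟩
    1# + x * (geometric n x + x ^ suc n)     ≈⟨ solve 3 (λ x g y → :1 :+ x :* (g :+ y) := :1 :+ x :* g :+ x :* y) refl x (geometric n x) (x ^ suc n) ⟩
    1# + x * geometric n x + x * x ^ suc n   ∎

  1-x^n : ∀ n x → (1# - x) * geometric n x ≈ 1# - x ^ suc n
  1-x^n n x = begin
    (1# - x) * geometric n x           ≈⟨ solve 2 (λ x g → (:1 :- x) :* g := g :- (:1 :+ x :* g) :+ :1) refl x (geometric n x) ⟩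
    geometric n x - geometric (suc n) x + 1#
      ≈⟨ +-congʳ (+-congˡ (-‿cong (geometric-suc n x))) ⟩
    geometric n x - (geometric n x + x ^ suc n) + 1#
      ≈⟨ solve 2 (λ g y → g :- (g :+ y) :+ :1 := :1 :- y) refl (geometric n x) (x ^ suc n) ⟩
    1# - x ^ suc n                    ∎

  1^n : ∀ n → 1# ^ n ≈ 1#
  1^n zero    = refl
  1^n (suc n) = trans (*-identityˡ _) (1^n n)

  module _ (n : ℕ) (ζ : Carrier) (geometric≈0 : geometric n ζ ≈ 0#)
           (cancellable-p : Cancellable (geometric n 1#)) where

    ζ^p≈1 : ζ ^ suc n ≈ 1#
    ζ^p≈1 = sym (x∙y⁻¹≈ε⇒x≈y 1# (ζ ^ suc n)
      (trans (sym (1-x^n n ζ)) (trans (*-congˡ geometric≈0) (zeroʳ _))))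

    ζ^kp≈1 : ∀ k → ζ ^ (k ℕ.* suc n) ≈ 1#
    ζ^kp≈1 k = begin
      ζ ^ (k ℕ.* suc n)   ≡⟨ ≡.cong (ζ ^_) (ℕ.*-comm k (suc n)) ⟩
      ζ ^ (suc n ℕ.* k)   ≈⟨ ^-assocʳ ζ (suc n) k ⟨
      (ζ ^ suc n) ^ k     ≈⟨ ^-congˡ k ζ^p≈1 ⟩
      1# ^ k              ≈⟨ 1^n k ⟩
      1#                  ∎

    -- Dividing 1 + x + ... + xⁿ by x - ζ leaves no remainder, and the quotient at x = 1 is the
    -- cofactor.
    1-ζ∣p : ∃ λ z → (1# - ζ) * z ≈ geometric n 1#
    1-ζ∣p = divide n geometric≈0
      where
      divide : ∀ k → geometric k ζ ≈ 0# → ∃ λ z → (1# - ζ) * z ≈ geometric k 1#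
      -- For k = 0 the hypothesis says 1 = 0: the ring is trivial and any witness serves.
      divide zero    1≈0 = 1# , (begin
        (1# - ζ) * 1#   ≈⟨ *-congˡ 1≈0 ⟩
        (1# - ζ) * 0#   ≈⟨ zeroʳ _ ⟩
        0#              ≈⟨ 1≈0 ⟨
        1#              ∎)
      divide (suc k) e = evalMonic q 1# , (begin
        (1# - ζ) * evalMonic q 1#                         ≈⟨ +-identityˡ _ ⟨
        0# + (1# - ζ) * evalMonic q 1#                    ≈⟨ +-congʳ e ⟨
        geometric (suc k) ζ + (1# - ζ) * evalMonic q 1#   ≈⟨ quotient-correct 1# (ones k) ζ 1# ⟨
        geometric (suc k) 1#                              ∎)
        where q = quotient (ones (suc k)) ζ

    cancellable-1-ζ : Cancellable (1# - ζ)
    cancellable-1-ζ = let (z , e) = 1-ζ∣p in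
      cancellable-factor (1# - ζ) z (cancellable-cong (sym e) cancellable-p)

    -- 1 - ζᵉ divides 1 - ζᵏᵉ, with a geometric sum as cofactor, and a factor of a cancellable
    -- element is cancellable.
    cancellable-multiple : ∀ e k → Cancellable (1# - ζ ^ (k ℕ.* e)) → Cancellable (1# - ζ ^ e)
    -- For k = 0 the hypothesis is that 0 is cancellable, so every element vanishes.
    cancellable-multiple e zero    c1-1 y _ = c1-1 y (trans (*-congʳ (-‿inverseʳ 1#)) (zeroˡ y))
    cancellable-multiple e (suc k) ck = cancellable-factor _ (geometric k (ζ ^ e)) (cancellable-cong (begin
      1# - ζ ^ (suc k ℕ.* e)              ≡⟨ ≡.cong (λ i → 1# - ζ ^ i) (ℕ.*-comm (suc k) e) ⟩
      1# - ζ ^ (e ℕ.* suc k)              ≈⟨ +-congˡ (-‿cong (^-assocʳ ζ e (suc k))) ⟨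
      1# - (ζ ^ e) ^ suc k                ≈⟨ 1-x^n k (ζ ^ e) ⟨
      (1# - ζ ^ e) * geometric k (ζ ^ e)  ∎) ck)

    -- A Bézout relation for e and p makes 1 - ζ, up to a unit, a multiple of 1 - ζᵉ.
    cancellable-1-ζ^ : ∀ e → Coprime (suc n) e → Cancellable (1# - ζ ^ e)
    cancellable-1-ζ^ e coprime with Coprime.coprime-Bézout coprime
    ... | Bézout.-+ x y 1+xp≡ye = cancellable-multiple e y (cancellable-cong
          (+-congˡ (-‿cong (begin
            ζ                           ≈⟨ *-identityʳ ζ ⟨
            ζ * 1#                      ≈⟨ *-congˡ (ζ^kp≈1 x) ⟨
            ζ ^ (1 ℕ.+ x ℕ.* suc n)     ≡⟨ ≡.cong (ζ ^_) 1+xp≡ye ⟩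
            ζ ^ (y ℕ.* e)               ∎))) cancellable-1-ζ)
    ... | Bézout.+- x y 1+ye≡xp = cancellable-multiple e y (cancellable-factor _ ζ (cancellable-cong (begin
            - (1# - ζ)                  ≈⟨ solve 1 (λ z → :- (:1 :- z) := z :- :1) refl ζ ⟩
            ζ - 1#                      ≈⟨ +-congˡ (-‿cong (ζ^kp≈1 x)) ⟨
            ζ - ζ ^ (x ℕ.* suc n)       ≡⟨ ≡.cong (λ k → ζ - ζ ^ k) 1+ye≡xp ⟨
            ζ - ζ * ζ ^ (y ℕ.* e)       ≈⟨ solve 2 (λ z w → z :- z :* w := (:1 :- w) :* z) refl ζ (ζ ^ (y ℕ.* e)) ⟩
            (1# - ζ ^ (y ℕ.* e)) * ζ    ∎) (cancellable-neg cancellable-1-ζ)))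

    -- (1 - ζᵉ)(1 + ζᵉ + ... + ζᵉⁿ) = 1 - (ζⁿ⁺¹)ᵉ = 0, and 1 - ζᵉ cancels.
    root-ζ^ : ∀ e → Coprime (suc n) e → Root (ones n) (ζ ^ e)
    root-ζ^ e coprime = cancellable-1-ζ^ e coprime _ (begin
      (1# - ζ ^ e) * geometric n (ζ ^ e)   ≈⟨ 1-x^n n (ζ ^ e) ⟩
      1# - (ζ ^ e) ^ suc n                 ≈⟨ +-congˡ (-‿cong (trans (^-assocʳ ζ e (suc n)) (ζ^kp≈1 e))) ⟩
      1# - 1#                              ≈⟨ -‿inverseʳ 1# ⟩
      0#                                   ∎)

    -- (1 - ξ) ζ = - (1 - ζ) makes 1 - ξ cancellable, and ξⁿ⁺¹ = 1. This allows ζ and ξ to exchange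
    -- roles later.
    geometric-inverse≈0 : ∀ ξ → ζ * ξ ≈ 1# → geometric n ξ ≈ 0#
    geometric-inverse≈0 ξ ζξ≈1 = cancellable-1-ξ _ (begin
      (1# - ξ) * geometric n ξ    ≈⟨ 1-x^n n ξ ⟩
      1# - ξ ^ suc n              ≈⟨ +-congˡ (-‿cong ξ^p≈1) ⟩
      1# - 1#                     ≈⟨ -‿inverseʳ 1# ⟩
      0#                          ∎)
      where
      cancellable-1-ξ : Cancellable (1# - ξ)
      cancellable-1-ξ = cancellable-factor _ ζ (cancellable-cong (begin
        - (1# - ζ)       ≈⟨ solve 1 (λ z → :- (:1 :- z) := z :- :1) refl ζ ⟩
        ζ - 1#           ≈⟨ +-congˡ (-‿cong ζξ≈1) ⟨
        ζ - ζ * ξ        ≈⟨ solve 2 (λ z w → z :- z :* w := (:1 :- w) :* z) refl ζ ξ ⟩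
        (1# - ξ) * ζ     ∎) (cancellable-neg cancellable-1-ζ))
      ξ^p≈1 : ξ ^ suc n ≈ 1#
      ξ^p≈1 = begin
        ξ ^ suc n                 ≈⟨ *-identityˡ _ ⟨
        1# * ξ ^ suc n            ≈⟨ *-congʳ ζ^p≈1 ⟨
        ζ ^ suc n * ξ ^ suc n     ≈⟨ ^-distrib-* ζ ξ (suc n) ⟨
        (ζ * ξ) ^ suc n           ≈⟨ ^-congˡ (suc n) ζξ≈1 ⟩
        1# ^ suc n                ≈⟨ 1^n (suc n) ⟩
        1#                        ∎

-- Arithmetic of odd exponents.

oddℕ : ℕ → ℕ
oddℕ j = suc (j ℕ.+ j)

odd+even : ∀ i x → oddℕ i ℕ.+ (x ℕ.+ x) ≡ oddℕ (x ℕ.+ i)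
odd+even = solve 2 (λ i x → con 1 :+ (i :+ i) :+ (x :+ x) := con 1 :+ ((x :+ i) :+ (x :+ i))) ≡.refl
  where open Data.Nat.Solver.+-*-Solver

odd+odd : ∀ i j → oddℕ i ℕ.+ oddℕ j ≡ suc (i ℕ.+ j) ℕ.+ suc (i ℕ.+ j)
odd+odd = solve 2 (λ i j → (con 1 :+ (i :+ i)) :+ (con 1 :+ (j :+ j)) := (con 1 :+ (i :+ j)) :+ (con 1 :+ (i :+ j))) ≡.refl
  where open Data.Nat.Solver.+-*-Solver

-- Differences of roots lead to 1 - ζ²ˣ, where 2x may exceed p even though x < p. Being prime to p
-- then depends on p being odd: p dividing 2x would have to divide 2 or x.
odd-prime⇒coprime-double : ∀ m x → Prime (oddℕ m) → 0 ℕ.< x → x ℕ.< oddℕ m → Coprime (oddℕ m) (x ℕ.+ x)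
odd-prime⇒coprime-double m (suc x) p-prime _ x<p {d} (d∣p , d∣2x) with prime⇒irreducible p-prime d∣p
... | inj₁ d≡1 = d≡1
... | inj₂ ≡.refl with euclidsLemma 2 (suc x) p-prime (≡.subst (oddℕ m ∣_) x+x≡2*x d∣2x)
  where
  x+x≡2*x : suc x ℕ.+ suc x ≡ 2 ℕ.* suc x
  x+x≡2*x = ≡.cong (suc x ℕ.+_) (≡.sym (ℕ.+-identityʳ (suc x)))
... | inj₂ p∣x = contradiction (∣⇒≤ p∣x) (ℕ.<⇒≱ x<p)
... | inj₁ p∣2 with m | ∣⇒≤ p∣2
-- Here d has been identified with `oddℕ 0`, which is 1.
...   | zero  | _ = ≡.refl
...   | suc k | s≤s (s≤s k+1+k≤0) with ≡.subst (ℕ._≤ 0) (ℕ.+-suc k k) k+1+k≤0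
...     | ()

-- The factorization of 1 + x + ... + xᵖ⁻¹ over the odd powers of ζ and its inverse.

module CyclotomicFactorization {c ℓ} (R : CommutativeRing c ℓ) where
  open CommutativeRing R
  open IntegerSolver R
  open MonicPolynomials R
  open RootsOfUnity R
  open Relation.Binary.Reasoning.Setoid setoid

  oddPowers : Carrier → Carrier → ℕ → List Carrier
  oddPowers ζ ξ zero    = []
  oddPowers ζ ξ (suc j) = ζ ^ oddℕ j ∷ ξ ^ oddℕ j ∷ oddPowers ζ ξ j

  length-oddPowers : ∀ ζ ξ j → length (oddPowers ζ ξ j) ≡ j ℕ.+ j
  length-oddPowers ζ ξ zero    = ≡.refl
  length-oddPowers ζ ξ (suc j) = ≡.cong suc
    (≡.trans (≡.cong suc (length-oddPowers ζ ξ j)) (≡.sym (ℕ.+-suc j j)))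

  All-oddPowers : ∀ {p} {P : Carrier → Set p} {ζ ξ} k →
    (∀ i → i ℕ.< k → P (ζ ^ oddℕ i) × P (ξ ^ oddℕ i)) → All P (oddPowers ζ ξ k)
  All-oddPowers zero    f = []
  All-oddPowers (suc k) f = let (pζ , pξ) = f k ℕ.≤-refl in
    pζ ∷ pξ ∷ All-oddPowers k (λ i i<k → f i (ℕ.m≤n⇒m≤1+n i<k))

  module _ (m : ℕ) (p-prime : Prime (oddℕ m)) (cancellable-p : Cancellable (geometric (m ℕ.+ m) 1#)) where

    -- Used for (ζ , ξ) and for (ξ , ζ). The four kinds of difference between a root of exponent
    -- `oddℕ i` and one of exponent `oddℕ j` form two mirror pairs, so two lemmas on differences
    -- suffice.
    module OrderedPair (ζ ξ : Carrier) (ζξ≈1 : ζ * ξ ≈ 1#) (geometric≈0 : geometric (m ℕ.+ m) ζ ≈ 0#) where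

      cancellable-ξ^ : ∀ e → Cancellable (ξ ^ e)
      cancellable-ξ^ e = cancellable-invertible (ζ ^ e) (begin
        ξ ^ e * ζ ^ e    ≈⟨ ^-distrib-* ξ ζ e ⟨
        (ξ * ζ) ^ e      ≈⟨ ^-congˡ e (trans (*-comm ξ ζ) ζξ≈1) ⟩
        1# ^ e           ≈⟨ 1^n e ⟩
        1#               ∎)

      cancellable-ζ^ : ∀ e → Cancellable (ζ ^ e)
      cancellable-ζ^ e = cancellable-invertible (ξ ^ e) (begin
        ζ ^ e * ξ ^ e    ≈⟨ ^-distrib-* ζ ξ e ⟨
        (ζ * ξ) ^ e      ≈⟨ ^-congˡ e ζξ≈1 ⟩
        1# ^ e           ≈⟨ 1^n e ⟩
        1#               ∎)

      cancellable-1-ζ^even : ∀ x → 0 ℕ.< x → x ℕ.< oddℕ m → Cancellable (1# - ζ ^ (x ℕ.+ x))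
      cancellable-1-ζ^even x 0<x x<p = cancellable-1-ζ^ (m ℕ.+ m) ζ geometric≈0 cancellable-p
        (x ℕ.+ x) (odd-prime⇒coprime-double m x p-prime 0<x x<p)

      -- ζⁱ - ζʲ = ζⁱ (1 - ζʲ⁻ⁱ), and the difference of two odd exponents is even.
      cancellable-ζ-ζ : ∀ i j → i ℕ.< j → j ℕ.< m → Cancellable (ζ ^ oddℕ i - ζ ^ oddℕ j)
      cancellable-ζ-ζ i j i<j j<m = cancellable-cong (begin
        ζ ^ oddℕ i * (1# - ζ ^ (x ℕ.+ x))       ≈⟨ solve 2 (λ a b → a :* (:1 :- b) := a :- a :* b) refl _ _ ⟩
        ζ ^ oddℕ i - ζ ^ oddℕ i * ζ ^ (x ℕ.+ x) ≈⟨ +-congˡ (-‿cong (^-homo-* ζ (oddℕ i) (x ℕ.+ x))) ⟨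
        ζ ^ oddℕ i - ζ ^ (oddℕ i ℕ.+ (x ℕ.+ x)) ≡⟨ ≡.cong (λ e → ζ ^ oddℕ i - ζ ^ e) exponent ⟩
        ζ ^ oddℕ i - ζ ^ oddℕ j                 ∎)
        (cancellable-* (cancellable-ζ^ (oddℕ i))
          (cancellable-1-ζ^even x (ℕ.m<n⇒0<n∸m i<j)
            (ℕ.≤-<-trans (ℕ.m∸n≤m j i) (ℕ.<-≤-trans j<m (ℕ.≤-trans (ℕ.m≤m+n m m) (ℕ.n≤1+n _))))))
        where
        x = j ℕ.∸ i
        exponent : oddℕ i ℕ.+ (x ℕ.+ x) ≡ oddℕ j
        exponent = ≡.trans (odd+even i x) (≡.cong oddℕ (ℕ.m∸n+n≡m (ℕ.<⇒≤ i<j)))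

      -- As ξ is inverse to ζ, ξⁱ - ζʲ = ξⁱ (1 - ζⁱ⁺ʲ), and the sum of two odd exponents is even.
      cancellable-ξ-ζ : ∀ i j → i ℕ.≤ j → j ℕ.< m → Cancellable (ξ ^ oddℕ i - ζ ^ oddℕ j)
      cancellable-ξ-ζ i j i≤j j<m = cancellable-cong (begin
        ξ ^ oddℕ i * (1# - ζ ^ (x ℕ.+ x))        ≡⟨ ≡.cong (λ e → ξ ^ oddℕ i * (1# - ζ ^ e)) (odd+odd i j) ⟨
        ξ ^ oddℕ i * (1# - ζ ^ (oddℕ i ℕ.+ oddℕ j))
          ≈⟨ *-congˡ (+-congˡ (-‿cong (^-homo-* ζ (oddℕ i) (oddℕ j)))) ⟩
        ξ ^ oddℕ i * (1# - ζ ^ oddℕ i * ζ ^ oddℕ j)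
          ≈⟨ solve 3 (λ a b c → a :* (:1 :- b :* c) := a :- (b :* a) :* c) refl _ _ _ ⟩
        ξ ^ oddℕ i - ζ ^ oddℕ i * ξ ^ oddℕ i * ζ ^ oddℕ j
          ≈⟨ +-congˡ (-‿cong (*-congʳ (trans (sym (^-distrib-* ζ ξ (oddℕ i)))
               (trans (^-congˡ (oddℕ i) ζξ≈1) (1^n (oddℕ i)))))) ⟩
        ξ ^ oddℕ i - 1# * ζ ^ oddℕ j             ≈⟨ +-congˡ (-‿cong (*-identityˡ _)) ⟩
        ξ ^ oddℕ i - ζ ^ oddℕ j                  ∎)
        (cancellable-* (cancellable-ξ^ (oddℕ i))
          (cancellable-1-ζ^even x (s≤s z≤n)
            (s≤s (ℕ.+-mono-≤ (ℕ.≤-<-trans i≤j j<m) (ℕ.<⇒≤ j<m)))))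
        where
        -- Half of `oddℕ i + oddℕ j`; it stays below p because i and j are below m.
        x = suc (i ℕ.+ j)

      root : ∀ i → i ℕ.< m → Root (ones (m ℕ.+ m)) (ζ ^ oddℕ i)
      root i i<m = root-ζ^ (m ℕ.+ m) ζ geometric≈0 cancellable-p (oddℕ i)
        (prime⇒coprime p-prime (s≤s (ℕ.+-mono-<-≤ i<m (ℕ.<⇒≤ i<m))))

    -- ζ, ζ⁻¹, ζ³, ζ⁻³, …, ζᵖ⁻², ζ²⁻ᵖ are all the roots of 1 + x + … + xᵖ⁻¹, evaluated here at x = 1.
    rootProduct-oddPowers : ∀ ζ ξ → ζ * ξ ≈ 1# → geometric (m ℕ.+ m) ζ ≈ 0# →
      rootProduct (oddPowers ζ ξ m) 1# ≈ geometric (m ℕ.+ m) 1#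
    rootProduct-oddPowers ζ ξ ζξ≈1 geometric≈0 = sym (evalMonic≈rootProduct
      (ones (m ℕ.+ m)) (oddPowers ζ ξ m)
      (≡.trans (length-replicate (m ℕ.+ m)) (≡.sym (length-oddPowers ζ ξ m)))
      (All-oddPowers m λ i i<m → Z.root i i<m , Ξ.root i i<m)
      (distinct m ℕ.≤-refl) 1#)
      where
      module Z = OrderedPair ζ ξ ζξ≈1 geometric≈0
      module Ξ = OrderedPair ξ ζ (trans (*-comm ξ ζ) ζξ≈1)
        (geometric-inverse≈0 (m ℕ.+ m) ζ geometric≈0 cancellable-p ξ ζξ≈1)
      distinct : ∀ k → k ℕ.≤ m → AllPairs (λ r s → Cancellable (s - r)) (oddPowers ζ ξ k)
      distinct zero    _   = []
      distinct (suc k) k<m =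
        (Z.cancellable-ξ-ζ k k ℕ.≤-refl k<m
          ∷ All-oddPowers k λ i i<k → Z.cancellable-ζ-ζ i k i<k k<m , Z.cancellable-ξ-ζ i k (ℕ.<⇒≤ i<k) k<m)
        ∷ (All-oddPowers k λ i i<k → Ξ.cancellable-ξ-ζ i k (ℕ.<⇒≤ i<k) k<m , Ξ.cancellable-ζ-ζ i k i<k k<m)
        ∷ distinct k (ℕ.<⇒≤ k<m)

-- Lucas sequences at even and odd indices.

-- For s = (a + b)² and n = - a b, lucasEven and lucasOdd are
-- a²ʲ + b²ʲ and (a²ʲ⁺¹ + b²ʲ⁺¹) / (a + b).
module Lucas {c ℓ} (R : CommutativeRing c ℓ) where
  open CommutativeRing R

  lucasEven lucasOdd : Carrier → Carrier → ℕ → Carrier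
  lucasEven s n zero    = 1# + 1#
  lucasEven s n (suc j) = s * lucasOdd s n j + n * lucasEven s n j
  lucasOdd  s n zero    = 1#
  lucasOdd  s n (suc j) = lucasEven s n (suc j) + n * lucasOdd s n j

  lucasEven-cong : ∀ {s s′ n n′} → s ≈ s′ → n ≈ n′ → ∀ j → lucasEven s n j ≈ lucasEven s′ n′ j
  lucasOdd-cong  : ∀ {s s′ n n′} → s ≈ s′ → n ≈ n′ → ∀ j → lucasOdd s n j ≈ lucasOdd s′ n′ j
  lucasEven-cong e f zero    = refl
  lucasEven-cong e f (suc j) = +-cong (*-cong e (lucasOdd-cong e f j)) (*-cong f (lucasEven-cong e f j))
  lucasOdd-cong  e f zero    = refl
  lucasOdd-cong  e f (suc j) = +-cong (lucasEven-cong e f (suc j)) (*-cong f (lucasOdd-cong e f j))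

  -- For t = a + b and n = - a b this is ∏ (aᵏ + bᵏ) over the first j odd numbers k; at j = m it is
  -- the w of the overview.
  lucasProduct : Carrier → Carrier → ℕ → Carrier
  lucasProduct t n zero    = 1#
  lucasProduct t n (suc j) = t * lucasOdd (t * t) n j * lucasProduct t n j

  lucasProduct-cong : ∀ {t t′ n n′} → t ≈ t′ → n ≈ n′ → ∀ j → lucasProduct t n j ≈ lucasProduct t′ n′ j
  lucasProduct-cong e f zero    = refl
  lucasProduct-cong e f (suc j) = *-cong (*-cong e (lucasOdd-cong (*-cong e e) f j)) (lucasProduct-cong e f j)

-- The square of the Lucas product, computed from invertible a and b.

module LucasSquares {c ℓ} (R : CommutativeRing c ℓ) where
  open CommutativeRing R
  open IntegerSolver R
  open MonicPolynomials R
  open RootsOfUnity R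
  open CyclotomicFactorization R
  open Lucas R
  open Algebra.Properties.Ring ring using (-‿distribˡ-*)
  open Relation.Binary.Reasoning.Setoid setoid

  neg^odd : ∀ x j → (- x) ^ oddℕ j ≈ - (x ^ oddℕ j)
  neg^odd x j = begin
    - x * (- x) ^ (j ℕ.+ j)           ≈⟨ *-congˡ (^-homo-* (- x) j j) ⟩
    - x * ((- x) ^ j * (- x) ^ j)     ≈⟨ *-congˡ (^-distrib-* (- x) (- x) j) ⟨
    - x * (- x * - x) ^ j             ≈⟨ *-congˡ (^-congˡ j (solve 1 (λ x → :- x :* :- x := x :* x) refl x)) ⟩
    - x * (x * x) ^ j                 ≈⟨ *-congˡ (^-distrib-* x x j) ⟩
    - x * (x ^ j * x ^ j)             ≈⟨ *-congˡ (^-homo-* x j j) ⟨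
    - x * x ^ (j ℕ.+ j)               ≈⟨ -‿distribˡ-* x _ ⟨
    - (x ^ oddℕ j)                    ∎

  module _ (a b a⁻¹ b⁻¹ : Carrier) (aa⁻¹≈1 : a * a⁻¹ ≈ 1#) (bb⁻¹≈1 : b * b⁻¹ ≈ 1#) where
    private
      s = (a + b) * (a + b)
      n = - (a * b)
      ζ = - (a * b⁻¹)
      ξ = - (b * a⁻¹)

    -- Both recursions are aᵏ⁺¹ + bᵏ⁺¹ = (a + b)(aᵏ + bᵏ) - a b (aᵏ⁻¹ + bᵏ⁻¹). As `lucasOdd` leaves
    -- out a factor a + b, the even case carries s = (a + b)².
    lucasEven≈ : ∀ j → lucasEven s n j ≈ a ^ (j ℕ.+ j) + b ^ (j ℕ.+ j)
    lucasOdd≈  : ∀ j → (a + b) * lucasOdd s n j ≈ a ^ oddℕ j + b ^ oddℕ j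
    lucasEven≈ zero    = refl
    lucasEven≈ (suc j) = begin
      (a + b) * (a + b) * lucasOdd s n j + n * lucasEven s n j
        ≈⟨ +-cong (trans (*-assoc _ _ _) (*-congˡ (lucasOdd≈ j))) (*-congˡ (lucasEven≈ j)) ⟩
      (a + b) * (a * x + b * y) + n * (x + y)
        ≈⟨ solve 4 (λ a b x y → (a :+ b) :* (a :* x :+ b :* y) :+ :- (a :* b) :* (x :+ y) := a :* (a :* x) :+ b :* (b :* y)) refl a b x y ⟩
      a * a ^ oddℕ j + b * b ^ oddℕ j
        ≡⟨ ≡.cong (λ e → a * a ^ e + b * b ^ e) (ℕ.+-suc j j) ⟨
      a ^ (suc j ℕ.+ suc j) + b ^ (suc j ℕ.+ suc j) ∎
      where
      x = a ^ (j ℕ.+ j)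
      y = b ^ (j ℕ.+ j)
    lucasOdd≈ zero    = solve 2 (λ a b → (a :+ b) :* :1 := a :* :1 :+ b :* :1) refl a b
    lucasOdd≈ (suc j) = begin
      (a + b) * (lucasEven s n (suc j) + n * lucasOdd s n j)
        ≈⟨ solve 4 (λ a b x y → (a :+ b) :* (x :+ :- (a :* b) :* y) := (a :+ b) :* x :+ :- (a :* b) :* ((a :+ b) :* y))
             refl a b (lucasEven s n (suc j)) (lucasOdd s n j) ⟩
      (a + b) * lucasEven s n (suc j) + n * ((a + b) * lucasOdd s n j)
        ≈⟨ +-cong (*-congˡ (lucasEven≈ (suc j))) (*-congˡ (lucasOdd≈ j)) ⟩
      (a + b) * (a ^ (suc j ℕ.+ suc j) + b ^ (suc j ℕ.+ suc j)) + n * (x + y)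
        ≡⟨ ≡.cong (λ e → (a + b) * (a ^ e + b ^ e) + n * (x + y)) (≡.cong suc (ℕ.+-suc j j)) ⟩
      (a + b) * (a * x + b * y) + n * (x + y)
        ≈⟨ solve 4 (λ a b x y → (a :+ b) :* (a :* x :+ b :* y) :+ :- (a :* b) :* (x :+ y) := a :* (a :* x) :+ b :* (b :* y)) refl a b x y ⟩
      a * (a * x) + b * (b * y)
        ≡⟨ ≡.cong (λ e → a ^ suc e + b ^ suc e) (≡.cong suc (ℕ.+-suc j j)) ⟨
      a ^ oddℕ (suc j) + b ^ oddℕ (suc j) ∎
      where
      x = a ^ oddℕ j
      y = b ^ oddℕ j

    ζb≈-a : ζ * b ≈ - a
    ζb≈-a = begin
      - (a * b⁻¹) * b        ≈⟨ solve 3 (λ a b b⁻¹ → :- (a :* b⁻¹) :* b := :- (a :* (b :* b⁻¹))) refl a b b⁻¹ ⟩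
      - (a * (b * b⁻¹))      ≈⟨ -‿cong (trans (*-congˡ bb⁻¹≈1) (*-identityʳ a)) ⟩
      - a                    ∎

    ξa≈-b : ξ * a ≈ - b
    ξa≈-b = begin
      - (b * a⁻¹) * a        ≈⟨ solve 3 (λ a b a⁻¹ → :- (b :* a⁻¹) :* a := :- (b :* (a :* a⁻¹))) refl a b a⁻¹ ⟩
      - (b * (a * a⁻¹))      ≈⟨ -‿cong (trans (*-congˡ aa⁻¹≈1) (*-identityʳ b)) ⟩
      - b                    ∎

    ζξ≈1 : ζ * ξ ≈ 1#
    ζξ≈1 = begin
      - (a * b⁻¹) * - (b * a⁻¹)   ≈⟨ solve 4 (λ a b a⁻¹ b⁻¹ → :- (a :* b⁻¹) :* :- (b :* a⁻¹) := (a :* a⁻¹) :* (b :* b⁻¹)) refl a b a⁻¹ b⁻¹ ⟩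
      (a * a⁻¹) * (b * b⁻¹)       ≈⟨ *-cong aa⁻¹≈1 bb⁻¹≈1 ⟩
      1# * 1#                     ≈⟨ *-identityˡ 1# ⟩
      1#                          ∎

    -- Here z plays the part of - x / y, and the odd exponent turns the minus sign into a plus. It
    -- serves for ζ and, with a and b exchanged, for ξ.
    1-x^odd : ∀ {x y z} → z * y ≈ - x → ∀ j → (1# - z ^ oddℕ j) * y ^ oddℕ j ≈ y ^ oddℕ j + x ^ oddℕ j
    1-x^odd {x} {y} {z} zy≈-x j = begin
      (1# - z ^ o) * y ^ o          ≈⟨ solve 2 (λ z y → (:1 :- z) :* y := y :- z :* y) refl (z ^ o) (y ^ o) ⟩
      y ^ o - z ^ o * y ^ o         ≈⟨ +-congˡ (-‿cong (^-distrib-* z y o)) ⟨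
      y ^ o - (z * y) ^ o           ≈⟨ +-congˡ (-‿cong (trans (^-congˡ o zy≈-x) (neg^odd x j))) ⟩
      y ^ o - - (x ^ o)             ≈⟨ solve 2 (λ x y → y :- :- x := y :+ x) refl (x ^ o) (y ^ o) ⟩
      y ^ o + x ^ o                 ∎
      where o = oddℕ j

    -- Turns the vanishing of V_m into ζ being a root of 1 + x + ... + x²ᵐ. Multiplied by a + b the
    -- identity would be immediate from `lucasOdd≈`, but a + b is not assumed cancellable, hence the
    -- induction.
    lucasOdd-geometric : ∀ j → b ^ (j ℕ.+ j) * geometric (j ℕ.+ j) ζ ≈ lucasOdd s n j
    lucasOdd-geometric zero    = *-identityˡ 1#
    lucasOdd-geometric (suc j) = begin
      b ^ (suc j ℕ.+ suc j) * geometric (suc j ℕ.+ suc j) ζ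
        ≡⟨ ≡.cong (λ e → b ^ suc e * geometric (suc e) ζ) (ℕ.+-suc j j) ⟩
      b * (b * x) * geometric (suc (suc (j ℕ.+ j))) ζ
        ≈⟨ *-congˡ (trans (geometric-suc (suc (j ℕ.+ j)) ζ) (+-congʳ (geometric-suc (j ℕ.+ j) ζ))) ⟩
      b * (b * x) * (g + ζ ^ oddℕ j + ζ * ζ ^ oddℕ j)
        ≈⟨ solve 5 (λ b x g z w → b :* (b :* x) :* (g :+ w :+ z :* w) := b :* b :* (x :* g) :+ (b :+ z :* b) :* (w :* (b :* x)))
             refl b x g ζ (ζ ^ oddℕ j) ⟩
      b * b * (x * g) + (b + ζ * b) * (ζ ^ oddℕ j * b ^ oddℕ j)
        ≈⟨ +-cong (*-congˡ (lucasOdd-geometric j)) (*-cong (+-congˡ ζb≈-a)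
             (trans (sym (^-distrib-* ζ b (oddℕ j))) (trans (^-congˡ (oddℕ j) ζb≈-a) (neg^odd a j)))) ⟩
      b * b * v + (b - a) * - (a ^ oddℕ j)
        -- Writing b² = b (a + b) - a b brings in (a + b) v, to which `lucasOdd≈` applies.
        ≈⟨ solve 4 (λ a b v y → b :* b :* v :+ (b :- a) :* :- y
             := b :* ((a :+ b) :* v) :- a :* b :* v :- (b :- a) :* y) refl a b v (a ^ oddℕ j) ⟩
      b * ((a + b) * v) - a * b * v - (b - a) * a ^ oddℕ j
        ≈⟨ +-congʳ (+-congʳ (*-congˡ (lucasOdd≈ j))) ⟩
      b * (a ^ oddℕ j + b ^ oddℕ j) - a * b * v - (b - a) * a ^ oddℕ j
        ≈⟨ solve 5 (λ a b v x y → b :* (x :+ y) :- a :* b :* v :- (b :- a) :* x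
             := a :* x :+ b :* y :+ :- (a :* b) :* v) refl a b v (a ^ oddℕ j) (b ^ oddℕ j) ⟩
      a * a ^ oddℕ j + b * b ^ oddℕ j + n * v
        ≡⟨ ≡.cong (λ e → a ^ suc e + b ^ suc e + n * v) (ℕ.+-suc j j) ⟨
      a ^ (suc j ℕ.+ suc j) + b ^ (suc j ℕ.+ suc j) + n * v
        ≈⟨ +-congʳ (lucasEven≈ (suc j)) ⟨
      lucasEven s n (suc j) + n * v ∎
      where
      x = b ^ (j ℕ.+ j)
      g = geometric (j ℕ.+ j) ζ
      v = lucasOdd s n j

    -- One copy of aᵏ + bᵏ is written as bᵏ (1 - ζᵏ), the other as aᵏ (1 - ξᵏ).
    lucasOdd-square : ∀ j → ((a + b) * lucasOdd s n j) * ((a + b) * lucasOdd s n j) ≈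
      (1# - ζ ^ oddℕ j) * (1# - ξ ^ oddℕ j) * (a * b) ^ oddℕ j
    lucasOdd-square j = begin
      ((a + b) * lucasOdd s n j) * ((a + b) * lucasOdd s n j)
        ≈⟨ *-cong (trans (lucasOdd≈ j) (+-comm x y)) (lucasOdd≈ j) ⟩
      (y + x) * (x + y)
        ≈⟨ *-cong (1-x^odd ζb≈-a j) (1-x^odd ξa≈-b j) ⟨
      ((1# - ζ ^ oddℕ j) * y) * ((1# - ξ ^ oddℕ j) * x)
        ≈⟨ solve 4 (λ z w x y → (z :* y) :* (w :* x) := z :* w :* (x :* y)) refl _ _ x y ⟩
      (1# - ζ ^ oddℕ j) * (1# - ξ ^ oddℕ j) * (x * y)
        ≈⟨ *-congˡ (^-distrib-* a b (oddℕ j)) ⟨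
      (1# - ζ ^ oddℕ j) * (1# - ξ ^ oddℕ j) * (a * b) ^ oddℕ j ∎
      where
      x = a ^ oddℕ j
      y = b ^ oddℕ j

    -- The exponents of a b add up as 1 + 3 + ... + (2j - 1) = j².
    lucasProduct-square : ∀ j → lucasProduct (a + b) n j * lucasProduct (a + b) n j ≈
      rootProduct (oddPowers ζ ξ j) 1# * (a * b) ^ (j ℕ.* j)
    lucasProduct-square zero    = refl
    lucasProduct-square (suc j) = begin
      (d * w) * (d * w)
        ≈⟨ solve 2 (λ d w → (d :* w) :* (d :* w) := (d :* d) :* (w :* w)) refl d w ⟩
      (d * d) * (w * w)
        ≈⟨ *-cong (lucasOdd-square j) (lucasProduct-square j) ⟩
      (z * x * ab ^ oddℕ j) * (rootProduct (oddPowers ζ ξ j) 1# * ab ^ (j ℕ.* j))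
        ≈⟨ solve 5 (λ z x c r c′ → (z :* x :* c) :* (r :* c′) := z :* (x :* r) :* (c :* c′)) refl z x _ _ _ ⟩
      z * (x * rootProduct (oddPowers ζ ξ j) 1#) * (ab ^ oddℕ j * ab ^ (j ℕ.* j))
        ≈⟨ *-congˡ (^-homo-* ab (oddℕ j) (j ℕ.* j)) ⟨
      rootProduct (oddPowers ζ ξ (suc j)) 1# * ab ^ (oddℕ j ℕ.+ j ℕ.* j)
        ≡⟨ ≡.cong (λ e → rootProduct (oddPowers ζ ξ (suc j)) 1# * ab ^ e) exponent ⟩
      rootProduct (oddPowers ζ ξ (suc j)) 1# * ab ^ (suc j ℕ.* suc j) ∎
      where
      d = (a + b) * lucasOdd s n j
      w = lucasProduct (a + b) n j
      z = 1# - ζ ^ oddℕ j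
      x = 1# - ξ ^ oddℕ j
      ab = a * b
      exponent : oddℕ j ℕ.+ j ℕ.* j ≡ suc j ℕ.* suc j
      exponent = ≡.cong suc (≡.trans (ℕ.+-assoc j j (j ℕ.* j)) (≡.cong (j ℕ.+_) (≡.sym (ℕ.*-suc j j))))

    -- The hypothesis that a b is p acts twice: it makes p cancellable, since a and b are
    -- invertible, and it turns the value p of the root product into one more factor a b.
    lucasProduct-square-mod : ∀ m → Prime (oddℕ m) → a * b ≈ geometric (m ℕ.+ m) 1# →
      lucasOdd s n m ≈ 0# →
      lucasProduct (a + b) n m * lucasProduct (a + b) n m ≈ (a * b) ^ suc (m ℕ.* m)
    lucasProduct-square-mod m p-prime ab≈p lucasOdd≈0 = begin
      lucasProduct (a + b) n m * lucasProduct (a + b) n m         ≈⟨ lucasProduct-square m ⟩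
      rootProduct (oddPowers ζ ξ m) 1# * (a * b) ^ (m ℕ.* m)      ≈⟨ *-congʳ (rootProduct-oddPowers m p-prime
          (cancellable-cong ab≈p cancellable-ab) ζ ξ ζξ≈1 geometric≈0) ⟩
      geometric (m ℕ.+ m) 1# * (a * b) ^ (m ℕ.* m)                ≈⟨ *-congʳ ab≈p ⟨
      (a * b) ^ suc (m ℕ.* m)                                     ∎
      where
      cancellable-a : Cancellable a
      cancellable-a = cancellable-invertible a⁻¹ aa⁻¹≈1
      cancellable-b : Cancellable b
      cancellable-b = cancellable-invertible b⁻¹ bb⁻¹≈1
      cancellable-ab : Cancellable (a * b)
      cancellable-ab = cancellable-* cancellable-a cancellable-b
      cancellable-b^ : ∀ k → Cancellable (b ^ k)
      cancellable-b^ zero    = cancellable-invertible 1# (*-identityˡ 1#)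
      cancellable-b^ (suc k) = cancellable-* cancellable-b (cancellable-b^ k)
      geometric≈0 : geometric (m ℕ.+ m) ζ ≈ 0#
      geometric≈0 = cancellable-b^ (m ℕ.+ m) _ (trans (lucasOdd-geometric m) lucasOdd≈0)

-- Quotients, quadratic extensions and the passage of Lucas sequences along homomorphisms.

module QuotientRing {c ℓ} (R : CommutativeRing c ℓ) (f : CommutativeRing.Carrier R) where
  open CommutativeRing R
  open IntegerSolver R

  infix 4 _≋_
  -- The carrier is kept and only equality is coarsened. A proof of equality contains the cofactor
  -- of f, so a computation in the quotient directly yields a divisibility in `R`.
  _≋_ : Carrier → Carrier → Set _
  x ≋ y = ∃ λ z → x ≈ y + f * z

  ≈⇒≋ : ∀ {x y} → x ≈ y → x ≋ y
  ≈⇒≋ {x} {y} e = 0# , trans e (solve 2 (λ y f → y := y :+ f :* :0) refl y f)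

  commutativeRing/ : CommutativeRing _ _
  commutativeRing/ = record
    { Carrier = Carrier
    ; _≈_ = _≋_
    ; _+_ = _+_
    ; _*_ = _*_
    ; -_ = -_
    ; 0# = 0#
    ; 1# = 1#
    ; isCommutativeRing = record
      { isRing = record
        { +-isAbelianGroup = record
          { isGroup = record
            { isMonoid = record
              { isSemigroup = record
                { isMagma = record
                  { isEquivalence = record
                    { refl = ≈⇒≋ refl
                    ; sym = λ { {x} {y} (z , e) → - z , trans
                        (solve 3 (λ y f z → y := y :+ f :* z :+ f :* :- z) refl y f z)
                        (+-congʳ (sym e)) }
                    ; trans = λ { {x} {y} {w} (z , e) (z′ , e′) → z′ + z , trans e (trans (+-congʳ e′)
                        (solve 4 (λ w f z z′ → w :+ f :* z′ :+ f :* z := w :+ f :* (z′ :+ z)) refl w f z z′)) }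
                    }
                  ; ∙-cong = λ { {x} {y} {u} {v} (z , e) (z′ , e′) → z + z′ , trans (+-cong e e′)
                      (solve 5 (λ y v f z z′ → (y :+ f :* z) :+ (v :+ f :* z′) := y :+ v :+ f :* (z :+ z′)) refl y v f z z′) }
                  }
                ; assoc = λ x y z → ≈⇒≋ (+-assoc x y z)
                }
              ; identity = (λ x → ≈⇒≋ (+-identityˡ x)) , λ x → ≈⇒≋ (+-identityʳ x)
              }
            ; inverse = (λ x → ≈⇒≋ (-‿inverseˡ x)) , λ x → ≈⇒≋ (-‿inverseʳ x)
            ; ⁻¹-cong = λ { {x} {y} (z , e) → - z , trans (-‿cong e)
                (solve 3 (λ y f z → :- (y :+ f :* z) := :- y :+ f :* :- z) refl y f z) }
            }
          ; comm = λ x y → ≈⇒≋ (+-comm x y)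
          }
        ; *-cong = λ { {x} {y} {u} {v} (z , e) (z′ , e′) → z * v + y * z′ + z * f * z′ , trans (*-cong e e′)
            (solve 5 (λ y v f z z′ → (y :+ f :* z) :* (v :+ f :* z′)
              := y :* v :+ f :* (z :* v :+ y :* z′ :+ z :* f :* z′)) refl y v f z z′) }
        ; *-assoc = λ x y z → ≈⇒≋ (*-assoc x y z)
        ; *-identity = (λ x → ≈⇒≋ (*-identityˡ x)) , λ x → ≈⇒≋ (*-identityʳ x)
        ; distrib = (λ x y z → ≈⇒≋ (distribˡ x y z)) , λ x y z → ≈⇒≋ (distribʳ x y z)
        }
      ; *-comm = λ x y → ≈⇒≋ (*-comm x y)
      }
    }

-- R[a] / (a² - t a - n), with (x , y) standing for x + y a.
module QuadraticExtension {c ℓ} (R : CommutativeRing c ℓ) (t n : CommutativeRing.Carrier R) where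
  open CommutativeRing R
  open IntegerSolver R

  commutativeRing[a] : CommutativeRing _ _
  commutativeRing[a] = record
    { Carrier = Carrier × Carrier
    ; _≈_ = λ (x , y) (x′ , y′) → x ≈ x′ × y ≈ y′
    ; _+_ = λ (x , y) (x′ , y′) → x + x′ , y + y′
    ; _*_ = λ (x , y) (x′ , y′) → x * x′ + n * (y * y′) , x * y′ + y * x′ + t * (y * y′)
    ; -_ = λ (x , y) → - x , - y
    ; 0# = 0# , 0#
    ; 1# = 1# , 0#
    ; isCommutativeRing = record
      { isRing = record
        { +-isAbelianGroup = record
          { isGroup = record
            { isMonoid = record
              { isSemigroup = record
                { isMagma = record
                  { isEquivalence = record
                    { refl = refl , refl
                    ; sym = λ (e , f) → sym e , sym f
                    ; trans = λ (e , f) (e′ , f′) → trans e e′ , trans f f′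
                    }
                  ; ∙-cong = λ (e , f) (e′ , f′) → +-cong e e′ , +-cong f f′
                  }
                ; assoc = λ (x , y) (x′ , y′) (x″ , y″) → +-assoc x x′ x″ , +-assoc y y′ y″
                }
              ; identity = (λ (x , y) → +-identityˡ x , +-identityˡ y) , λ (x , y) → +-identityʳ x , +-identityʳ y
              }
            ; inverse = (λ (x , y) → -‿inverseˡ x , -‿inverseˡ y) , λ (x , y) → -‿inverseʳ x , -‿inverseʳ y
            ; ⁻¹-cong = λ (e , f) → -‿cong e , -‿cong f
            }
          ; comm = λ (x , y) (x′ , y′) → +-comm x x′ , +-comm y y′
          }
        ; *-cong = λ (e , f) (e′ , f′) →
            +-cong (*-cong e e′) (*-congˡ (*-cong f f′)) ,
            +-cong (+-cong (*-cong e f′) (*-cong f e′)) (*-congˡ (*-cong f f′))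
        ; *-assoc = λ (x , y) (x′ , y′) (x″ , y″) →
            solve 8 (λ t n x y x′ y′ x″ y″ →
              (x :* x′ :+ n :* (y :* y′)) :* x″ :+ n :* ((x :* y′ :+ y :* x′ :+ t :* (y :* y′)) :* y″)
              := x :* (x′ :* x″ :+ n :* (y′ :* y″)) :+ n :* (y :* (x′ :* y″ :+ y′ :* x″ :+ t :* (y′ :* y″))))
              refl t n x y x′ y′ x″ y″ ,
            solve 8 (λ t n x y x′ y′ x″ y″ →
              (x :* x′ :+ n :* (y :* y′)) :* y″ :+ (x :* y′ :+ y :* x′ :+ t :* (y :* y′)) :* x″
                :+ t :* ((x :* y′ :+ y :* x′ :+ t :* (y :* y′)) :* y″)
              := x :* (x′ :* y″ :+ y′ :* x″ :+ t :* (y′ :* y″)) :+ y :* (x′ :* x″ :+ n :* (y′ :* y″))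
                :+ t :* (y :* (x′ :* y″ :+ y′ :* x″ :+ t :* (y′ :* y″))))
              refl t n x y x′ y′ x″ y″
        ; *-identity =
            (λ (x , y) → solve 3 (λ n x y → :1 :* x :+ n :* (:0 :* y) := x) refl n x y ,
                         solve 3 (λ t x y → :1 :* y :+ :0 :* x :+ t :* (:0 :* y) := y) refl t x y) ,
            (λ (x , y) → solve 3 (λ n x y → x :* :1 :+ n :* (y :* :0) := x) refl n x y ,
                         solve 3 (λ t x y → x :* :0 :+ y :* :1 :+ t :* (y :* :0) := y) refl t x y)
        ; distrib =
            (λ (x , y) (x′ , y′) (x″ , y″) →
              solve 7 (λ n x y x′ y′ x″ y″ → x :* (x′ :+ x″) :+ n :* (y :* (y′ :+ y″))
                := x :* x′ :+ n :* (y :* y′) :+ (x :* x″ :+ n :* (y :* y″))) refl n x y x′ y′ x″ y″ ,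
              solve 7 (λ t x y x′ y′ x″ y″ → x :* (y′ :+ y″) :+ y :* (x′ :+ x″) :+ t :* (y :* (y′ :+ y″))
                := x :* y′ :+ y :* x′ :+ t :* (y :* y′) :+ (x :* y″ :+ y :* x″ :+ t :* (y :* y″))) refl t x y x′ y′ x″ y″) ,
            (λ (x , y) (x′ , y′) (x″ , y″) →
              solve 7 (λ n x y x′ y′ x″ y″ → (x′ :+ x″) :* x :+ n :* ((y′ :+ y″) :* y)
                := x′ :* x :+ n :* (y′ :* y) :+ (x″ :* x :+ n :* (y″ :* y))) refl n x y x′ y′ x″ y″ ,
              solve 7 (λ t x y x′ y′ x″ y″ → (x′ :+ x″) :* y :+ (y′ :+ y″) :* x :+ t :* ((y′ :+ y″) :* y)
                := x′ :* y :+ y′ :* x :+ t :* (y′ :* y) :+ (x″ :* y :+ y″ :* x :+ t :* (y″ :* y))) refl t x y x′ y′ x″ y″)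
        }
      ; *-comm = λ (x , y) (x′ , y′) →
          solve 5 (λ n x y x′ y′ → x :* x′ :+ n :* (y :* y′) := x′ :* x :+ n :* (y′ :* y)) refl n x y x′ y′ ,
          solve 5 (λ t x y x′ y′ → x :* y′ :+ y :* x′ :+ t :* (y :* y′) := x′ :* y :+ y′ :* x :+ t :* (y′ :* y)) refl t x y x′ y′
      }
    }

module LucasHomomorphism {c ℓ c′ ℓ′} (R : CommutativeRing c ℓ) (S : CommutativeRing c′ ℓ′)
  (φ : CommutativeRing.Carrier R → CommutativeRing.Carrier S)
  (isHomomorphism : RingMorphisms.IsRingHomomorphism (CommutativeRing.rawRing R) (CommutativeRing.rawRing S) φ) where
  private
    module R = CommutativeRing R
  open CommutativeRing S
  open RingMorphisms.IsRingHomomorphism isHomomorphism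
  open Relation.Binary.Reasoning.Setoid setoid
  private
    module LR = Lucas R
    module LS = Lucas S
    module UR = RootsOfUnity R
    module US = RootsOfUnity S

  lucasEven-homo : ∀ s n j → φ (LR.lucasEven s n j) ≈ LS.lucasEven (φ s) (φ n) j
  lucasOdd-homo  : ∀ s n j → φ (LR.lucasOdd s n j) ≈ LS.lucasOdd (φ s) (φ n) j
  lucasEven-homo s n zero    = trans (+-homo _ _) (+-cong 1#-homo 1#-homo)
  lucasEven-homo s n (suc j) = trans (+-homo _ _) (+-cong
    (trans (*-homo _ _) (*-congˡ (lucasOdd-homo s n j)))
    (trans (*-homo _ _) (*-congˡ (lucasEven-homo s n j))))
  lucasOdd-homo  s n zero    = 1#-homo
  lucasOdd-homo  s n (suc j) = trans (+-homo _ _) (+-cong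
    (lucasEven-homo s n (suc j))
    (trans (*-homo _ _) (*-congˡ (lucasOdd-homo s n j))))

  lucasProduct-homo : ∀ t n j → φ (LR.lucasProduct t n j) ≈ LS.lucasProduct (φ t) (φ n) j
  lucasProduct-homo t n zero    = 1#-homo
  lucasProduct-homo t n (suc j) = begin
    φ (t R.* LR.lucasOdd (t R.* t) n j R.* LR.lucasProduct t n j)
      ≈⟨ trans (*-homo _ _) (*-congʳ (*-homo _ _)) ⟩
    φ t * φ (LR.lucasOdd (t R.* t) n j) * φ (LR.lucasProduct t n j)
      ≈⟨ *-cong (*-congˡ (trans (lucasOdd-homo (t R.* t) n j) (LS.lucasOdd-cong (*-homo t t) refl j)))
           (lucasProduct-homo t n j) ⟩
    φ t * LS.lucasOdd (φ t * φ t) (φ n) j * LS.lucasProduct (φ t) (φ n) j ∎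

  ^-homo : ∀ x k → φ (x UR.^ k) ≈ φ x US.^ k
  ^-homo x zero    = 1#-homo
  ^-homo x (suc k) = trans (*-homo _ _) (*-congˡ (^-homo x k))

  geometric-homo : ∀ k x → φ (UR.geometric k x) ≈ US.geometric k (φ x)
  geometric-homo zero    x = 1#-homo
  geometric-homo (suc k) x = trans (+-homo _ _) (+-cong 1#-homo (trans (*-homo _ _) (*-congˡ (geometric-homo k x))))

-- V_m divides (w - C)(w + C).

module LucasDivisibility {c ℓ} (R : CommutativeRing c ℓ) where
  open CommutativeRing R
  open IntegerSolver R
  open Lucas R
  open Relation.Binary.Reasoning.Setoid setoid
  open RootsOfUnity R using (_^_; geometric; ^-homo-*)

  -- In `S`, the ring modulo f with a root a of a² - t a + c adjoined, f vanishes, t = a + b and c =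
  -- a b, so `lucasProduct-square-mod` applies. Both sides of the result come from the base ring,
  -- and the first coordinate of an equality in `S` is a congruence modulo f.
  lucasOdd∣lucasProduct²-c^ : ∀ t c c⁻¹ m → c * c⁻¹ ≈ 1# → Prime (oddℕ m) → c ≈ geometric (m ℕ.+ m) 1# →
    ∃ λ z → lucasProduct t (- c) m * lucasProduct t (- c) m
      ≈ c ^ suc (m ℕ.* m) + lucasOdd (t * t) (- c) m * z
  lucasOdd∣lucasProduct²-c^ t c c⁻¹ m cc⁻¹≈1 p-prime c≈p = proj₁ (S.trans
      (S.trans (*-homo w w) (S.*-cong (lucasProduct-homo t (- c) m) (lucasProduct-homo t (- c) m)))
      (S.trans (S.*-cong φw≈ φw≈)
      (S.trans (LucasSquares.lucasProduct-square-mod S a b a⁻¹ b⁻¹ (inverse a b ab≈φc) (inverse b a ba≈φc) m p-prime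
         (S.trans ab≈φc (S.trans (⟦⟧-cong (≈⇒≋ c≈p)) (geometric-homo (m ℕ.+ m) 1#)))
         (S.trans (LS.lucasOdd-cong (S.sym (S.*-cong φt≈a+b φt≈a+b)) (S.sym φ-c≈-ab) m)
         (S.trans (LS.lucasOdd-cong (S.sym (*-homo t t)) S.refl m)
         (S.trans (S.sym (lucasOdd-homo (t * t) (- c) m)) (⟦⟧-cong f≋0)))))
      (S.trans (US.^-congˡ (suc (m ℕ.* m)) ab≈φc) (S.sym (^-homo c (suc (m ℕ.* m))))))))
    where
    f = lucasOdd (t * t) (- c) m
    w = lucasProduct t (- c) m
    open QuotientRing R f
    S = QuadraticExtension.commutativeRing[a] commutativeRing/ t (- c)
    module S = CommutativeRing S
    module LS = Lucas S
    module US = RootsOfUnity S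
    φ : Carrier → S.Carrier
    φ x = x , 0#
    isHomomorphism : RingMorphisms.IsRingHomomorphism rawRing S.rawRing φ
    isHomomorphism = record
      { isSemiringHomomorphism = record
        { isNearSemiringHomomorphism = record
          { +-isMonoidHomomorphism = record
            { isMagmaHomomorphism = record
              { isRelHomomorphism = record { cong = λ e → ≈⇒≋ e , ≈⇒≋ refl }
              ; homo = λ x y → ≈⇒≋ refl , ≈⇒≋ (sym (+-identityˡ 0#))
              }
            ; ε-homo = ≈⇒≋ refl , ≈⇒≋ refl
            }
          ; *-homo = λ x y →
              ≈⇒≋ (solve 3 (λ x y n → x :* y := x :* y :+ n :* (:0 :* :0)) refl x y (- c)) ,
              ≈⇒≋ (solve 3 (λ x y t → :0 := x :* :0 :+ :0 :* y :+ t :* (:0 :* :0)) refl x y t)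
          }
        ; 1#-homo = ≈⇒≋ refl , ≈⇒≋ refl
        }
      ; -‿homo = λ x → ≈⇒≋ refl , ≈⇒≋ (solve 0 (:0 := :- :0) refl)
      }
    open LucasHomomorphism R S φ isHomomorphism
    open RingMorphisms.IsRingHomomorphism isHomomorphism using (*-homo; -‿homo)
    ⟦⟧-cong : ∀ {x y} → x ≋ y → φ x S.≈ φ y
    ⟦⟧-cong e = e , ≈⇒≋ refl
    a b a⁻¹ b⁻¹ : S.Carrier
    -- The adjoined root and its conjugate b = t - a. Their product is c, so b / c and a / c are
    -- their inverses.
    a = 0# , 1#
    b = t , - 1#
    a⁻¹ = b S.* φ c⁻¹
    b⁻¹ = a S.* φ c⁻¹
    ab≈φc : a S.* b S.≈ φ c
    ab≈φc = ≈⇒≋ (solve 2 (λ t c → :0 :* t :+ :- c :* (:1 :* :- :1) := c) refl t c)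
          , ≈⇒≋ (solve 1 (λ t → :0 :* :- :1 :+ :1 :* t :+ t :* (:1 :* :- :1) := :0) refl t)
    ba≈φc : b S.* a S.≈ φ c
    ba≈φc = S.trans (S.*-comm b a) ab≈φc
    inverse : ∀ x y → x S.* y S.≈ φ c → x S.* (y S.* φ c⁻¹) S.≈ S.1#
    inverse x y xy≈φc = S.trans (S.sym (S.*-assoc x y (φ c⁻¹))) (S.trans (S.*-congʳ xy≈φc)
      (S.trans (S.sym (*-homo c c⁻¹)) (⟦⟧-cong (≈⇒≋ cc⁻¹≈1))))
    φt≈a+b : φ t S.≈ a S.+ b
    φt≈a+b = ≈⇒≋ (sym (+-identityˡ t)) , ≈⇒≋ (sym (-‿inverseʳ 1#))
    φ-c≈-ab : φ (- c) S.≈ S.- (a S.* b)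
    φ-c≈-ab = S.trans (-‿homo c) (S.-‿cong (S.sym ab≈φc))
    φw≈ : LS.lucasProduct (φ t) (φ (- c)) m S.≈ LS.lucasProduct (a S.+ b) (S.- (a S.* b)) m
    φw≈ = LS.lucasProduct-cong φt≈a+b φ-c≈-ab m
    f≋0 : f ≋ 0#
    f≋0 = 1# , trans (sym (*-identityʳ f)) (sym (+-identityˡ _))

  lucasOdd∣[lucasProduct-C][lucasProduct+C] : ∀ t c c⁻¹ m k C → c * c⁻¹ ≈ 1# → Prime (oddℕ m) →
    c ≈ geometric (m ℕ.+ m) 1# → suc (m ℕ.* m) ≡ k ℕ.+ k → C ≈ c ^ k →
    ∃ λ z → (lucasProduct t (- c) m - C) * (lucasProduct t (- c) m + C) ≈ lucasOdd (t * t) (- c) m * z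
  lucasOdd∣[lucasProduct-C][lucasProduct+C] t c c⁻¹ m k C cc⁻¹≈1 p-prime c≈p exponent C≈c^k =
    let (z , w²≈) = lucasOdd∣lucasProduct²-c^ t c c⁻¹ m cc⁻¹≈1 p-prime c≈p in z , (begin
      (w - C) * (w + C)                    ≈⟨ solve 2 (λ w C → (w :- C) :* (w :+ C) := w :* w :- C :* C) refl w C ⟩
      w * w - C * C                        ≈⟨ +-cong w²≈ (-‿cong (*-cong C≈c^k C≈c^k)) ⟩
      c ^ suc (m ℕ.* m) + f * z - c ^ k * c ^ k
        ≡⟨ ≡.cong (λ e → c ^ e + f * z - c ^ k * c ^ k) exponent ⟩
      c ^ (k ℕ.+ k) + f * z - c ^ k * c ^ k
        ≈⟨ +-congʳ (+-congʳ (^-homo-* c k k)) ⟩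
      c ^ k * c ^ k + f * z - c ^ k * c ^ k
        ≈⟨ solve 2 (λ x y → x :+ y :- x := y) refl (c ^ k * c ^ k) (f * z) ⟩
      f * z                                ∎)
    where
    f = lucasOdd (t * t) (- c) m
    w = lucasProduct t (- c) m

-- Degrees of polynomials.

module Degree {c ℓ} (K : CommutativeRing c ℓ) where
  private module K = CommutativeRing K
  open PolynomialRing K
  private module K[x] = CommutativeRing commutativeRing
  open Relation.Binary.Reasoning.Setoid K.setoid

  -- Unlike `HasDegree`, this bound also covers the zero polynomial. Since `n < m` unfolds to
  -- `suc n ≤ m`, the second half of `HasDegree p n` is `DegreeBelow p (suc n)`.
  DegreeBelow : Poly → ℕ → Set ℓ
  DegreeBelow p n = ∀ m → n ℕ.≤ m → coeff p m K.≈ K.0#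

  degreeBelow-mono : ∀ p {m n} → m ℕ.≤ n → DegreeBelow p m → DegreeBelow p n
  degreeBelow-mono p m≤n b k n≤k = b k (ℕ.≤-trans m≤n n≤k)

  degreeBelow-cong : ∀ {p q n} → p ≈ q → DegreeBelow p n → DegreeBelow q n
  degreeBelow-cong e b m n≤m = K.trans (K.sym (coeff-≈ e m)) (b m n≤m)

  degreeBelow-length : ∀ p → DegreeBelow p (length p)
  degreeBelow-length []      m       _         = K.refl
  degreeBelow-length (a ∷ p) (suc m) (s≤s l≤m) = degreeBelow-length p m l≤m

  degreeBelow-const : ∀ a → DegreeBelow (const a) 1
  degreeBelow-const a = degreeBelow-length (const a)

  degreeBelow-tail : ∀ {a p n} → DegreeBelow (a ∷ p) (suc n) → DegreeBelow p n
  degreeBelow-tail b m n≤m = b (suc m) (s≤s n≤m)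

  degreeBelow-0 : ∀ p → DegreeBelow p 0 → p ≈ []
  degreeBelow-0 p b = mk≈ λ n → b n z≤n

  degreeBelow-1 : ∀ p → DegreeBelow p 1 → p ≈ const (coeff p 0)
  degreeBelow-1 p b = mk≈ λ { zero → K.refl ; (suc n) → b (suc n) (s≤s z≤n) }

  degreeBelow-+ : ∀ p q {n} → DegreeBelow p n → DegreeBelow q n → DegreeBelow (p + q) n
  degreeBelow-+ p q b b′ m n≤m = K.trans (coeff-+ p q m)
    (K.trans (K.+-cong (b m n≤m) (b′ m n≤m)) (K.+-identityˡ K.0#))

  degreeBelow-neg : ∀ p {n} → DegreeBelow p n → DegreeBelow (- p) n
  degreeBelow-neg p b m n≤m = K.trans (coeff-neg p m) (K.trans (K.-‿cong (b m n≤m))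
    (K.trans (K.sym (K.+-identityˡ _)) (K.-‿inverseʳ K.0#)))

  degreeBelow-∷ : ∀ {a p n} → DegreeBelow p n → DegreeBelow (a ∷ p) (suc n)
  degreeBelow-∷ b (suc m) (s≤s n≤m) = b m n≤m

  coeff-∷-* : ∀ a p q n → coeff ((a ∷ p) * q) (suc n) K.≈ a K.* coeff q (suc n) K.+ coeff (p * q) n
  coeff-∷-* a p q n = K.trans (coeff-+ (a · q) (K.0# ∷ (p * q)) (suc n)) (K.+-congʳ (coeff-· a q (suc n)))

  constant-* : ∀ {a p} q → DegreeBelow (a ∷ p) 1 → (a ∷ p) * q ≈ a · q
  constant-* {a} q b = K[x].trans (*-cong (degreeBelow-1 (a ∷ _) b) K[x].refl) (const-* a q)

  degreeBelow-* : ∀ p q {m n} → DegreeBelow p (suc m) → DegreeBelow q (suc n) →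
    DegreeBelow (p * q) (suc (m ℕ.+ n))
  degreeBelow-* []      q             bp bq k       _ = K.refl
  degreeBelow-* (a ∷ p) q {zero}      bp bq k       n<k = begin
    coeff ((a ∷ p) * q) k     ≈⟨ coeff-≈ (constant-* q bp) k ⟩
    coeff (a · q) k           ≈⟨ coeff-· a q k ⟩
    a K.* coeff q k           ≈⟨ K.*-congˡ (bq k n<k) ⟩
    a K.* K.0#                ≈⟨ K.zeroʳ a ⟩
    K.0#                      ∎
  degreeBelow-* (a ∷ p) q {suc m} {n} bp bq (suc k) (s≤s m+n<k) = begin
    coeff ((a ∷ p) * q) (suc k)                      ≈⟨ coeff-∷-* a p q k ⟩
    a K.* coeff q (suc k) K.+ coeff (p * q) k        ≈⟨ K.+-cong
        (K.*-congˡ (bq (suc k) (s≤s (ℕ.≤-trans (ℕ.m≤n+m n m) (ℕ.≤-trans (ℕ.n≤1+n _) m+n<k)))))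
        (degreeBelow-* p q (degreeBelow-tail bp) bq k m+n<k) ⟩
    a K.* K.0# K.+ K.0#                              ≈⟨ K.+-identityʳ _ ⟩
    a K.* K.0#                                       ≈⟨ K.zeroʳ a ⟩
    K.0#                                             ∎

  leadingCoeff-* : ∀ p q {m n} → DegreeBelow p (suc m) → DegreeBelow q (suc n) →
    coeff (p * q) (m ℕ.+ n) K.≈ coeff p m K.* coeff q n
  leadingCoeff-* []      q         bp bq = K.sym (K.zeroˡ _)
  leadingCoeff-* (a ∷ p) q {zero}  {n} bp bq = K.trans (coeff-≈ (constant-* q bp) n) (coeff-· a q n)
  leadingCoeff-* (a ∷ p) q {suc m} {n} bp bq = begin
    coeff ((a ∷ p) * q) (suc (m ℕ.+ n))                               ≈⟨ coeff-∷-* a p q (m ℕ.+ n) ⟩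
    a K.* coeff q (suc (m ℕ.+ n)) K.+ coeff (p * q) (m ℕ.+ n)         ≈⟨ K.+-cong
        (K.*-congˡ (bq (suc (m ℕ.+ n)) (s≤s (ℕ.m≤n+m n m))))
        (leadingCoeff-* p q (degreeBelow-tail bp) bq) ⟩
    a K.* K.0# K.+ coeff p m K.* coeff q n                            ≈⟨ K.+-congʳ (K.zeroʳ a) ⟩
    K.0# K.+ coeff p m K.* coeff q n                                  ≈⟨ K.+-identityˡ _ ⟩
    coeff p m K.* coeff q n                                           ∎

  degreeBelow-pred : ∀ p {n} → DegreeBelow p (suc n) → coeff p n K.≈ K.0# → DegreeBelow p n
  degreeBelow-pred p b e m n≤m with ℕ.m≤n⇒m<n∨m≡n n≤m
  ... | inj₁ n<m    = b m n<m
  ... | inj₂ ≡.refl = e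

  hasDegree-cong : ∀ {p q n} → p ≈ q → HasDegree p n → HasDegree q n
  hasDegree-cong {n = n} e (pn≉0 , b) =
    (λ qn≈0 → pn≉0 (K.trans (coeff-≈ e n) qn≈0)) , degreeBelow-cong e b

  hasDegree-unique : ∀ p {m n} → HasDegree p m → HasDegree p n → m ≡ n
  hasDegree-unique p {m} {n} (pm≉0 , bm) (pn≉0 , bn) with ℕ.<-cmp m n
  ... | tri< m<n _ _ = contradiction (bm n m<n) pn≉0
  ... | tri≈ _ m≡n _ = m≡n
  ... | tri> _ _ n<m = contradiction (bn m n<m) pm≉0

  hasDegree-+ : ∀ p q {n} → HasDegree p n → DegreeBelow q n → HasDegree (p + q) n
  hasDegree-+ p q {n} (pn≉0 , bp) bq =
    (λ e → pn≉0 (begin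
      coeff p n               ≈⟨ K.+-identityʳ _ ⟨
      coeff p n K.+ K.0#      ≈⟨ K.+-congˡ (bq n ℕ.≤-refl) ⟨
      coeff p n K.+ coeff q n ≈⟨ coeff-+ p q n ⟨
      coeff (p + q) n         ≈⟨ e ⟩
      K.0#                    ∎)) ,
    degreeBelow-+ p q bp (degreeBelow-mono q (ℕ.n≤1+n n) bq)

-- The alternative in `inverse` also decides whether an element is zero, as finding degrees and
-- dividing polynomials require.
record IsDecidableField {c ℓ} (K : CommutativeRing c ℓ) : Set (c ⊔ ℓ) where
  open CommutativeRing K
  field
    inverse : ∀ x → x ≈ 0# ⊎ ∃ λ y → x * y ≈ 1#
    1≉0     : ¬ 1# ≈ 0#

-- Euclid's algorithm and proper factors over a field.

module FieldPolynomials {c ℓ} (K : CommutativeRing c ℓ) (isField : IsDecidableField K) where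
  open IsDecidableField isField
  private module K = CommutativeRing K
  open PolynomialRing K
  open Degree K
  private module K[x] = CommutativeRing commutativeRing
  open IntegerSolver commutativeRing
  open Relation.Binary.Reasoning.Setoid K[x].setoid

  x*y≉0 : ∀ {x y} → ¬ x K.≈ K.0# → ¬ y K.≈ K.0# → ¬ x K.* y K.≈ K.0#
  x*y≉0 {x} {y} x≉0 y≉0 xy≈0 with inverse x
  ... | inj₁ x≈0 = x≉0 x≈0
  ... | inj₂ (x⁻¹ , xx⁻¹≈1) = y≉0 (K.trans (K.sym (K.*-identityˡ y)) (K.trans (K.*-congʳ (K.trans (K.sym xx⁻¹≈1) (K.*-comm x x⁻¹)))
      (K.trans (K.*-assoc x⁻¹ x y) (K.trans (K.*-congˡ xy≈0) (K.zeroʳ x⁻¹)))))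

  hasDegree-* : ∀ p q {m n} → HasDegree p m → HasDegree q n → HasDegree (p * q) (m ℕ.+ n)
  hasDegree-* p q (pm≉0 , bp) (qn≉0 , bq) =
    (λ e → x*y≉0 pm≉0 qn≉0 (K.trans (K.sym (leadingCoeff-* p q bp bq)) e)) , degreeBelow-* p q bp bq

  degreeBelow⇒degree : ∀ p n → DegreeBelow p n → p ≈ [] ⊎ ∃ (HasDegree p)
  degreeBelow⇒degree p zero    b = inj₁ (degreeBelow-0 p b)
  degreeBelow⇒degree p (suc n) b with inverse (coeff p n)
  ... | inj₂ (y , pn*y≈1) = inj₂ (n , (λ pn≈0 → 1≉0 (K.trans (K.sym pn*y≈1) (K.trans (K.*-congʳ pn≈0) (K.zeroˡ y)))) , b)
  ... | inj₁ pn≈0 = degreeBelow⇒degree p n (degreeBelow-pred p b pn≈0)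


  degree : ∀ p → p ≈ [] ⊎ ∃ (HasDegree p)
  degree p = degreeBelow⇒degree p (length p) (degreeBelow-length p)

  hasDegree⇒≉0 : ∀ p {n} → HasDegree p n → ¬ p ≈ []
  hasDegree⇒≉0 p {n} (pn≉0 , _) p≈0 = pn≉0 (coeff-≈ p≈0 n)

  hasDegree-0⇒unit : ∀ p → HasDegree p 0 → ∃ λ u → p * u ≈ 1#
  hasDegree-0⇒unit p (p0≉0 , b) with inverse (coeff p 0)
  ... | inj₁ p0≈0 = contradiction p0≈0 p0≉0
  ... | inj₂ (y , e) = const y , (begin
    p * const y                      ≈⟨ *-cong {q = const y} (degreeBelow-1 p b) K[x].refl ⟩
    const (coeff p 0) * const y      ≈⟨ const-homo-* (coeff p 0) y ⟨
    const (coeff p 0 K.* y)          ≈⟨ const-cong e ⟩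
    1#                               ∎)

  monomial : K.Carrier → ℕ → Poly
  monomial a zero    = const a
  monomial a (suc n) = K.0# ∷ monomial a n

  degreeBelow-monomial : ∀ a n → DegreeBelow (monomial a n) (suc n)
  degreeBelow-monomial a zero    = degreeBelow-const a
  degreeBelow-monomial a (suc n) = degreeBelow-∷ (degreeBelow-monomial a n)

  coeff-monomial : ∀ a n → coeff (monomial a n) n ≡ a
  coeff-monomial a zero    = ≡.refl
  coeff-monomial a (suc n) = coeff-monomial a n

  Bézout : Poly → Poly → Set _
  Bézout p q = ∃ λ k → (∃ λ u → p ≈ k * u) × (∃ λ v → q ≈ k * v) × ∃₂ λ x y → k ≈ x * p + y * q

  bézout-sym : ∀ {p q} → Bézout p q → Bézout q p
  bézout-sym (k , k∣p , k∣q , x , y , e) = k , k∣q , k∣p , y , x , K[x].trans e (+-comm (x * _) (y * _))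

  bézout-step : ∀ {p q} z → Bézout (p + (- (z * q))) q → Bézout p q
  bézout-step {p} {q} z (k , (u , p-zq≈ku) , (v , q≈kv) , x , y , e) =
    k , (u + z * v , (begin
      p                            ≈⟨ solve 3 (λ p q z → p := (p :+ (:- (z :* q))) :+ z :* q) K[x].refl p q z ⟩
      p + (- (z * q)) + z * q      ≈⟨ +-cong p-zq≈ku (*-cong {z} K[x].refl q≈kv) ⟩
      k * u + z * (k * v)          ≈⟨ solve 4 (λ k u v z → k :* u :+ z :* (k :* v) := k :* (u :+ z :* v)) K[x].refl k u v z ⟩
      k * (u + z * v)              ∎)) , (v , q≈kv) ,
    x , y + (- (x * z)) , K[x].trans e
      (solve 5 (λ p q x y z → x :* (p :+ (:- (z :* q))) :+ y :* q := x :* p :+ (y :+ (:- (x :* z))) :* q) K[x].refl p q x y z)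

  -- Removes just the top term, with z the monomial (pₘ / qₙ) xᵐ⁻ⁿ.
  divisionStep : ∀ p q {m n} y → n ℕ.≤ m → DegreeBelow p (suc m) → DegreeBelow q (suc n) →
    coeff q n K.* y K.≈ K.1# → ∃ λ z → DegreeBelow (p + (- (z * q))) m
  divisionStep p q {m} {n} y n≤m bp bq qn*y≈1 = z , degreeBelow-pred (p + (- (z * q)))
      (degreeBelow-+ p (- (z * q)) bp (degreeBelow-neg (z * q) (≡.subst (λ k → DegreeBelow (z * q) (suc k)) e+n≡m
        (degreeBelow-* z q (degreeBelow-monomial a e) bq))))
      (K.trans (coeff-+ p (- (z * q)) m) (K.trans (K.+-congˡ (K.trans (coeff-neg (z * q) m) (K.-‿cong top))) (K.-‿inverseʳ _)))
    where
    e = m ℕ.∸ n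
    a = coeff p m K.* y
    z = monomial a e
    e+n≡m : e ℕ.+ n ≡ m
    e+n≡m = ℕ.m∸n+n≡m n≤m
    top : coeff (z * q) m K.≈ coeff p m
    top = K.trans (K.reflexive (≡.cong (coeff (z * q)) (≡.sym e+n≡m)))
      (K.trans (leadingCoeff-* z q (degreeBelow-monomial a e) bq)
      (K.trans (K.*-congʳ (K.reflexive (coeff-monomial a e)))
      (K.trans (K.*-assoc _ y _)
      (K.trans (K.*-congˡ (K.trans (K.*-comm y _) qn*y≈1)) (K.*-identityʳ _)))))

  -- Recursion on d, a bound for the sum of the two degree bounds. Every call lowers one of them by
  -- one, by discarding a zero top coefficient or by a division step.
  bézout-below : ∀ d m n {p q} → m ℕ.+ n ℕ.≤ d → DegreeBelow p m → DegreeBelow q n → Bézout p q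
  bézout-below d zero n {p} {q} _ bp bq = q ,
    ([] , K[x].trans (degreeBelow-0 p bp) (K[x].sym (*-zeroʳ q))) ,
    (1# , K[x].sym (K[x].*-identityʳ q)) ,
    [] , 1# , K[x].sym (*-identityˡ q)
  bézout-below d (suc m) zero {p} {q} _ bp bq = bézout-sym (p ,
    ([] , K[x].trans (degreeBelow-0 q bq) (K[x].sym (*-zeroʳ p))) ,
    (1# , K[x].sym (K[x].*-identityʳ p)) ,
    [] , 1# , K[x].sym (*-identityˡ p))
  bézout-below (suc d) (suc m) (suc n) {p} {q} (s≤s m+1+n≤d) bp bq with inverse (coeff p m) | inverse (coeff q n) | ℕ.≤-total n m
  ... | inj₁ pm≈0    | _             | _ = bézout-below d m (suc n) m+1+n≤d (degreeBelow-pred p bp pm≈0) bq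
  ... | inj₂ _       | inj₁ qn≈0     | _ = bézout-below d (suc m) n (≡.subst (ℕ._≤ d) (ℕ.+-suc m n) m+1+n≤d) bp (degreeBelow-pred q bq qn≈0)
  ... | inj₂ _       | inj₂ (y , e)  | inj₁ n≤m =
    let (z , b) = divisionStep p q y n≤m bp bq e in bézout-step z (bézout-below d m (suc n) m+1+n≤d b bq)
  ... | inj₂ (y , e) | inj₂ _        | inj₂ m≤n =
    let (z , b) = divisionStep q p y m≤n bq bp e in bézout-sym (bézout-step z (bézout-sym
      (bézout-below d (suc m) n (≡.subst (ℕ._≤ d) (ℕ.+-suc m n) m+1+n≤d) bp b)))

  bézout : ∀ p q → Bézout p q
  bézout p q = bézout-below _ _ _ ℕ.≤-refl (degreeBelow-length p) (degreeBelow-length q)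

  Divides : Poly → Poly → Set _
  Divides f p = ∃ λ z → p ≈ f * z

  -- Let k = gcd(f, u) = x f + y u and f = k k′. If k were a unit, v would be a multiple of x v f +
  -- y u v and so of f; if k′ were a unit, f would divide k and so u.
  zero-divisor⇒factorization : ∀ f {n} → HasDegree f n → ∀ u v → Divides f (u * v) → ¬ Divides f u → ¬ Divides f v →
    ∃₂ λ p q → ∃₂ λ i j → HasDegree p (suc i) × HasDegree q (suc j) × f ≈ p * q
  zero-divisor⇒factorization f hf u v (w , uv≈fw) f∤u f∤v with bézout f u
  ... | (k , (k′ , f≈kk′) , (u′ , u≈ku′) , x , y , k≈xf+yu) with degree k | degree k′
  ... | inj₁ k≈0 | _ = contradiction (K[x].trans f≈kk′ (≈0-* k′ k≈0)) (hasDegree⇒≉0 f hf)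
  ... | _ | inj₁ k′≈0 = contradiction (K[x].trans f≈kk′ (K[x].trans (*-cong {k} K[x].refl k′≈0) (*-zeroʳ k))) (hasDegree⇒≉0 f hf)
  ... | inj₂ (suc i , hk) | inj₂ (suc j , hk′) = k , k′ , i , j , hk , hk′ , f≈kk′
  ... | inj₂ (zero , hk) | inj₂ _ = let (r , kr≈1) = hasDegree-0⇒unit k hk in
    contradiction (r * (x * v + y * w) , (begin
      v                                ≈⟨ K[x].*-identityʳ v ⟨
      v * 1#                           ≈⟨ *-cong {v} {v} {k * r} {1#} K[x].refl kr≈1 ⟨
      v * (k * r)                      ≈⟨ *-cong {v} K[x].refl (*-cong {k} {x * f + y * u} {r} k≈xf+yu K[x].refl) ⟩
      v * ((x * f + y * u) * r)        ≈⟨ solve 6 (λ f u v x y r → v :* ((x :* f :+ y :* u) :* r)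
                                            := r :* (x :* v :* f :+ y :* (u :* v))) K[x].refl f u v x y r ⟩
      r * (x * v * f + y * (u * v))    ≈⟨ *-cong {r} K[x].refl (+-congˡ {x * v * f} (*-cong {y} K[x].refl uv≈fw)) ⟩
      r * (x * v * f + y * (f * w))    ≈⟨ solve 6 (λ f v x y r w → r :* (x :* v :* f :+ y :* (f :* w))
                                            := f :* (r :* (x :* v :+ y :* w))) K[x].refl f v x y r w ⟩
      f * (r * (x * v + y * w))        ∎)) f∤v
  ... | inj₂ (suc i , hk) | inj₂ (zero , hk′) = let (r , k′r≈1) = hasDegree-0⇒unit k′ hk′ in
    contradiction (r * u′ , (begin
      u                     ≈⟨ u≈ku′ ⟩
      k * u′                ≈⟨ *-cong {k} K[x].refl (*-identityˡ u′) ⟨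
      k * (1# * u′)         ≈⟨ *-cong {k} K[x].refl (*-cong {k′ * r} {1#} {u′} k′r≈1 K[x].refl) ⟨
      k * (k′ * r * u′)     ≈⟨ solve 4 (λ k k′ r u′ → k :* (k′ :* r :* u′) := k :* k′ :* (r :* u′)) K[x].refl k k′ r u′ ⟩
      k * k′ * (r * u′)     ≈⟨ *-cong {q = r * u′} f≈kk′ K[x].refl ⟨
      f * (r * u′)          ∎)) f∤u

-- Homogenizing polynomials at the pair d, h.

module Homogenization {c ℓ} (K : CommutativeRing c ℓ) (d h : List (CommutativeRing.Carrier K)) where
  private module K = CommutativeRing K
  open PolynomialRing K
  open Degree K
  open CommutativeRing commutativeRing using (refl; sym; trans; setoid; +-congʳ; *-congˡ; *-congʳ)
  open RootsOfUnity commutativeRing using (_^_; ^-homo-*)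
  open IntegerSolver commutativeRing
  open Lucas commutativeRing
  open Relation.Binary.Reasoning.Setoid setoid

  -- hⁿ p(d / h)
  homogenize : ℕ → Poly → Poly
  homogenize zero    p       = const (coeff p 0)
  homogenize (suc n) []      = []
  homogenize (suc n) (a ∷ p) = const a * h ^ suc n + d * homogenize n p

  homogenize-0 : ∀ n {p} → p ≈ [] → homogenize n p ≈ []
  homogenize-0 zero            e = 0∷0 (coeff-≈ e 0)
  homogenize-0 (suc n) {[]}    e = refl
  homogenize-0 (suc n) {a ∷ p} e = begin
    const a * h ^ suc n + d * homogenize n p
      ≈⟨ +-cong (*-congʳ (0∷0 (coeff-≈ e 0))) (*-congˡ {d} (homogenize-0 n (tail-≈0 e))) ⟩
    [] + d * []
      ≈⟨ *-zeroʳ d ⟩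
    [] ∎

  homogenize-cong : ∀ n {p q} → p ≈ q → homogenize n p ≈ homogenize n q
  homogenize-cong zero                    e = const-cong (coeff-≈ e 0)
  homogenize-cong (suc n) {[]}    {q}     e = sym (homogenize-0 (suc n) (sym e))
  homogenize-cong (suc n) {a ∷ p} {[]}    e = homogenize-0 (suc n) e
  homogenize-cong (suc n) {a ∷ p} {b ∷ q} e =
    +-cong (*-congʳ (const-cong (coeff-≈ e 0))) (*-congˡ {d} (homogenize-cong n (tail-≈ e)))

  homogenize-+ : ∀ n p q → homogenize n (p + q) ≈ homogenize n p + homogenize n q
  homogenize-+ zero    p       q       = const-cong (coeff-+ p q 0)
  homogenize-+ (suc n) []      q       = refl
  homogenize-+ (suc n) (a ∷ p) []      = sym (+-identityʳ _)
  homogenize-+ (suc n) (a ∷ p) (b ∷ q) = begin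
    (const a + const b) * h ^ suc n + d * homogenize n (p + q)
      ≈⟨ +-congˡ {(const a + const b) * h ^ suc n} (*-congˡ {d} (homogenize-+ n p q)) ⟩
    (const a + const b) * h ^ suc n + d * (homogenize n p + homogenize n q)
      ≈⟨ solve 6 (λ a b h d x y → (a :+ b) :* h :+ d :* (x :+ y) := (a :* h :+ d :* x) :+ (b :* h :+ d :* y))
           refl (const a) (const b) (h ^ suc n) d (homogenize n p) (homogenize n q) ⟩
    homogenize (suc n) (a ∷ p) + homogenize (suc n) (b ∷ q) ∎

  homogenize-· : ∀ n a p → homogenize n (a · p) ≈ const a * homogenize n p
  homogenize-· zero    a p       = trans (const-cong (coeff-· a p 0)) (const-homo-* a (coeff p 0))
  homogenize-· (suc n) a []      = sym (*-zeroʳ (const a))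
  homogenize-· (suc n) a (b ∷ p) = begin
    const (a K.* b) * h ^ suc n + d * homogenize n (a · p)
      ≈⟨ +-cong (*-congʳ (const-homo-* a b)) (*-congˡ {d} (homogenize-· n a p)) ⟩
    const a * const b * h ^ suc n + d * (const a * homogenize n p)
      ≈⟨ solve 5 (λ a b h d x → a :* b :* h :+ d :* (a :* x) := a :* (b :* h :+ d :* x))
           refl (const a) (const b) (h ^ suc n) d (homogenize n p) ⟩
    const a * homogenize (suc n) (b ∷ p) ∎

  homogenize-0∷ : ∀ n p → homogenize (suc n) (K.0# ∷ p) ≈ d * homogenize n p
  homogenize-0∷ n p = +-congʳ {d * homogenize n p} (*-congʳ {h ^ suc n} (0∷0 K.refl))

  homogenize-suc : ∀ n p → DegreeBelow p (suc n) → homogenize (suc n) p ≈ h * homogenize n p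
  homogenize-suc n       []      b = sym (trans (*-congˡ {h} (homogenize-0 n refl)) (*-zeroʳ h))
  homogenize-suc zero    (a ∷ p) b = begin
    const a * (h * 1#) + d * const (coeff p 0)
      ≈⟨ +-congˡ {const a * (h * 1#)} (trans (*-congˡ {d} (0∷0 (b 1 ℕ.≤-refl))) (*-zeroʳ d)) ⟩
    const a * (h * 1#) + []
      ≈⟨ solve 2 (λ a h → a :* (h :* :1) :+ :0 := h :* a) refl (const a) h ⟩
    h * const a ∎
  homogenize-suc (suc n) (a ∷ p) b = begin
    const a * (h * h ^ suc n) + d * homogenize (suc n) p
      ≈⟨ +-congˡ {const a * (h * h ^ suc n)} (*-congˡ {d} (homogenize-suc n p (λ m n<m → b (suc m) (s≤s n<m)))) ⟩
    const a * (h * h ^ suc n) + d * (h * homogenize n p)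
      ≈⟨ solve 5 (λ a h h′ d x → a :* (h :* h′) :+ d :* (h :* x) := h :* (a :* h′ :+ d :* x))
           refl (const a) h (h ^ suc n) d (homogenize n p) ⟩
    h * homogenize (suc n) (a ∷ p) ∎

  homogenize-raise : ∀ k n p → DegreeBelow p (suc n) → homogenize (k ℕ.+ n) p ≈ h ^ k * homogenize n p
  homogenize-raise zero    n p b = sym (*-identityˡ _)
  homogenize-raise (suc k) n p b = begin
    homogenize (suc (k ℕ.+ n)) p
      ≈⟨ homogenize-suc (k ℕ.+ n) p (degreeBelow-mono p (s≤s (ℕ.m≤n+m n k)) b) ⟩
    h * homogenize (k ℕ.+ n) p
      ≈⟨ *-congˡ {h} (homogenize-raise k n p b) ⟩
    h * (h ^ k * homogenize n p)
      ≈⟨ *-assoc h (h ^ k) (homogenize n p) ⟨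
    h ^ suc k * homogenize n p ∎

  homogenize-* : ∀ m n p q → DegreeBelow p (suc m) → DegreeBelow q (suc n) →
    homogenize (m ℕ.+ n) (p * q) ≈ homogenize m p * homogenize n q
  homogenize-* m n [] q bp bq = begin
    homogenize (m ℕ.+ n) []              ≈⟨ homogenize-0 (m ℕ.+ n) refl ⟩
    [] * homogenize n q                  ≈⟨ *-congʳ {homogenize n q} (homogenize-0 m refl) ⟨
    homogenize m [] * homogenize n q     ∎
  homogenize-* zero n (a ∷ p) q bp bq = begin
    homogenize n ((a ∷ p) * q)           ≈⟨ homogenize-cong n (constant-* q bp) ⟩
    homogenize n (a · q)                 ≈⟨ homogenize-· n a q ⟩
    const a * homogenize n q             ∎
  homogenize-* (suc m) n (a ∷ p) q bp bq = begin
    homogenize (suc m ℕ.+ n) (a · q + (K.0# ∷ (p * q)))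
      ≈⟨ homogenize-+ (suc m ℕ.+ n) (a · q) (K.0# ∷ (p * q)) ⟩
    homogenize (suc m ℕ.+ n) (a · q) + homogenize (suc m ℕ.+ n) (K.0# ∷ (p * q))
      ≈⟨ +-cong (trans (homogenize-· (suc m ℕ.+ n) a q) (*-congˡ {const a} (homogenize-raise (suc m) n q bq)))
           (trans (homogenize-0∷ (m ℕ.+ n) (p * q)) (*-congˡ {d} (homogenize-* m n p q (λ k m<k → bp (suc k) (s≤s m<k)) bq))) ⟩
    const a * (h ^ suc m * y) + d * (x * y)
      ≈⟨ solve 5 (λ a h d x y → a :* (h :* y) :+ d :* (x :* y) := (a :* h :+ d :* x) :* y) refl (const a) (h ^ suc m) d x y ⟩
    homogenize (suc m) (a ∷ p) * y ∎
    where
    x = homogenize m p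
    y = homogenize n q

  -- Keeps the bound deg p ≤ n next to the value: `homogenize n` ignores coefficients beyond n, so
  -- it is multiplicative only under such bounds.
  record Homogenizes (n : ℕ) (p y : Poly) : Set ℓ where
    constructor homogenizes
    field
      degree≤ : DegreeBelow p (suc n)
      value   : homogenize n p ≈ y
  open Homogenizes

  homogenizes-self : ∀ {n p} → DegreeBelow p (suc n) → Homogenizes n p (homogenize n p)
  homogenizes-self b = homogenizes b refl

  homogenizes-congʳ : ∀ {n p y z} → y ≈ z → Homogenizes n p y → Homogenizes n p z
  homogenizes-congʳ y≈z (homogenizes b e) = homogenizes b (trans e y≈z)

  homogenizes-const : ∀ a → Homogenizes 0 (const a) (const a)
  homogenizes-const a = homogenizes (degreeBelow-const a) refl

  homogenizes-X : Homogenizes 1 X d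
  homogenizes-X = homogenizes (degreeBelow-length X)
    (trans (homogenize-0∷ 0 1#) (trans (*-comm d 1#) (*-identityˡ d)))

  homogenizes-+ : ∀ {n p q y z} → Homogenizes n p y → Homogenizes n q z → Homogenizes n (p + q) (y + z)
  homogenizes-+ {n} {p} {q} (homogenizes b e) (homogenizes b′ e′) =
    homogenizes (degreeBelow-+ p q b b′) (trans (homogenize-+ n p q) (+-cong e e′))

  homogenizes-* : ∀ {m n p q y z} → Homogenizes m p y → Homogenizes n q z → Homogenizes (m ℕ.+ n) (p * q) (y * z)
  homogenizes-* {m} {n} {p} {q} (homogenizes b e) (homogenizes b′ e′) =
    homogenizes (degreeBelow-* p q b b′) (trans (homogenize-* m n p q b b′) (*-cong e e′))

  homogenizes-raise : ∀ k {n p y} → Homogenizes n p y → Homogenizes (k ℕ.+ n) p (h ^ k * y)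
  homogenizes-raise k {n} {p} (homogenizes b e) = homogenizes
    (degreeBelow-mono p (s≤s (ℕ.m≤n+m n k)) b)
    (trans (homogenize-raise k n p b) (*-congˡ {h ^ k} e))

  module _ {s s′ n n′} (hs : Homogenizes 2 s s′) (hn : Homogenizes 2 n n′) where
    -- Giving s and n weight 2 makes both sequences homogeneous of weight 2j. Written as `j * 2`,
    -- the weight unfolds to `2 + …` at each step of the recursion.
    homogenizes-lucasEven : ∀ j → Homogenizes (j ℕ.* 2) (lucasEven s n j) (lucasEven s′ n′ j)
    homogenizes-lucasOdd  : ∀ j → Homogenizes (j ℕ.* 2) (lucasOdd s n j) (lucasOdd s′ n′ j)
    homogenizes-lucasEven zero    = homogenizes-const _
    homogenizes-lucasEven (suc j) = homogenizes-+
      (homogenizes-* hs (homogenizes-lucasOdd j)) (homogenizes-* hn (homogenizes-lucasEven j))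
    homogenizes-lucasOdd  zero    = homogenizes-const _
    homogenizes-lucasOdd  (suc j) = homogenizes-+
      (homogenizes-lucasEven (suc j)) (homogenizes-* hn (homogenizes-lucasOdd j))

-- The substitution of - x for x, as homogenization at - x and 1.

module Reflection {c ℓ} (K : CommutativeRing c ℓ) where
  open PolynomialRing K
  open Degree K
  open CommutativeRing commutativeRing using (refl; sym; trans; setoid; *-congˡ; *-congʳ)
  open RootsOfUnity commutativeRing using (_^_; 1^n; ^-congˡ)
  open IntegerSolver commutativeRing
  open Lucas commutativeRing
  open LucasSquares commutativeRing using (neg^odd)
  open Homogenization K (- X) 1#
  open Relation.Binary.Reasoning.Setoid setoid

  -- y is p(- x)
  Reflects : Poly → Poly → Set _
  Reflects p y = ∃ λ n → Homogenizes n p y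

  -- With h = 1 the power of h is 1, so the formal degree can be raised freely, and sums of
  -- polynomials of different degrees can be reflected.
  raise-reflection : ∀ k {n p y} → Homogenizes n p y → Homogenizes (k ℕ.+ n) p y
  raise-reflection k {y = y} hp = homogenizes-congʳ
    (trans (*-congʳ {y} (1^n k)) (*-identityˡ y)) (homogenizes-raise k hp)

  reflects-unique : ∀ {p q y z} → p ≈ q → Reflects p y → Reflects q z → y ≈ z
  reflects-unique {p} {q} {y} {z} p≈q (m , hp) (n , hq) = begin
    y                          ≈⟨ Homogenizes.value (raise-reflection n hp) ⟨
    homogenize (n ℕ.+ m) p     ≈⟨ homogenize-cong (n ℕ.+ m) p≈q ⟩
    homogenize (n ℕ.+ m) q     ≡⟨ ≡.cong (λ k → homogenize k q) (ℕ.+-comm n m) ⟩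
    homogenize (m ℕ.+ n) q     ≈⟨ Homogenizes.value (raise-reflection m hq) ⟩
    z                          ∎

  reflects-+ : ∀ {p q y z} → Reflects p y → Reflects q z → Reflects (p + q) (y + z)
  reflects-+ {p} {y = y} (m , hp) (n , hq) = m ℕ.+ n , homogenizes-+
    (≡.subst (λ k → Homogenizes k p y) (ℕ.+-comm n m) (raise-reflection n hp))
    (raise-reflection m hq)

  reflects-* : ∀ {p q y z} → Reflects p y → Reflects q z → Reflects (p * q) (y * z)
  reflects-* (m , hp) (n , hq) = m ℕ.+ n , homogenizes-* hp hq

  reflects-const : ∀ a → Reflects (const a) (const a)
  reflects-const a = 0 , homogenizes-const a

  reflects-any : ∀ p → ∃ (Reflects p)
  reflects-any p = homogenize (length p) p , length p ,
    homogenizes-self (degreeBelow-mono p (ℕ.n≤1+n _) (degreeBelow-length p))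

  -- Each of the j factors is t times a polynomial in t², so each contributes one sign.
  lucasProduct-neg : ∀ t n j → lucasProduct (- t) n j ≈ (- 1#) ^ j * lucasProduct t n j
  lucasProduct-neg t n zero    = sym (*-identityˡ 1#)
  lucasProduct-neg t n (suc j) = begin
    - t * lucasOdd (- t * - t) n j * lucasProduct (- t) n j
      ≈⟨ *-cong (*-congˡ { - t} (lucasOdd-cong (solve 1 (λ t → :- t :* :- t := t :* t) refl t) refl j)) (lucasProduct-neg t n j) ⟩
    - t * v * ((- 1#) ^ j * w)
      ≈⟨ solve 4 (λ t v e w → :- t :* v :* (e :* w) := (:- :1 :* e) :* (t :* v :* w)) refl t v ((- 1#) ^ j) w ⟩
    (- 1#) ^ suc j * lucasProduct t n (suc j) ∎
    where
    v = lucasOdd (t * t) n j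
    w = lucasProduct t n j

  lucasProduct-neg-odd : ∀ t n r → lucasProduct (- t) n (oddℕ r) ≈ - lucasProduct t n (oddℕ r)
  lucasProduct-neg-odd t n r = begin
    lucasProduct (- t) n (oddℕ r)                ≈⟨ lucasProduct-neg t n (oddℕ r) ⟩
    (- 1#) ^ oddℕ r * w                          ≈⟨ *-congʳ {w} (neg^odd 1# r) ⟩
    - (1# ^ oddℕ r) * w                          ≈⟨ *-congʳ {w} (-‿cong (1^n (oddℕ r))) ⟩
    - 1# * w                                     ≈⟨ solve 1 (λ w → :- :1 :* w := :- w) refl w ⟩
    - w                                          ∎
    where w = lucasProduct t n (oddℕ r)

  reflects-lucasOdd : ∀ b j → Reflects (lucasOdd (X * X) (const b) j) (lucasOdd (X * X) (const b) j)
  reflects-lucasOdd b j = j ℕ.* 2 , homogenizes-congʳ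
    (lucasOdd-cong (solve 1 (λ t → :- t :* :- t := t :* t) refl X) refl j)
    (homogenizes-lucasOdd (homogenizes-* homogenizes-X homogenizes-X)
      (raise-reflection 2 (homogenizes-const b)) j)

  reflects-lucasProduct : ∀ b j → Reflects (lucasProduct X (const b) j) (lucasProduct (- X) (const b) j)
  reflects-lucasProduct b zero    = reflects-const _
  reflects-lucasProduct b (suc j) = reflects-*
    (reflects-* (1 , homogenizes-X) (j ℕ.* 2 , homogenizes-lucasOdd (homogenizes-* homogenizes-X homogenizes-X)
      (raise-reflection 2 (homogenizes-const b)) j))
    (reflects-lucasProduct b j)

-- Reducibility of V_m over a field and of its homogenization.

module LucasReducibility {c ℓ} (K : CommutativeRing c ℓ) (isField : IsDecidableField K) where
  open IsDecidableField isField using (1≉0)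
  private module K = CommutativeRing K
  open PolynomialRing K
  open Degree K
  open FieldPolynomials K isField
  open CommutativeRing commutativeRing using (refl; sym; trans; setoid; *-congˡ; *-congʳ)
  open RootsOfUnity commutativeRing using (_^_; geometric; ^-homo-*)
  open IntegerSolver commutativeRing
  open Lucas commutativeRing
  open Relation.Binary.Reasoning.Setoid setoid
  private module U = RootsOfUnity K

  const-isRingHomomorphism : RingMorphisms.IsRingHomomorphism K.rawRing rawRing const
  const-isRingHomomorphism = record
    { isSemiringHomomorphism = record
      { isNearSemiringHomomorphism = record
        { +-isMonoidHomomorphism = record
          { isMagmaHomomorphism = record
            { isRelHomomorphism = record { cong = const-cong }
            ; homo = λ a b → refl
            }
          ; ε-homo = 0∷0 K.refl
          }
        ; *-homo = const-homo-*
        }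
      ; 1#-homo = refl
      }
    ; -‿homo = λ a → refl
    }
  open LucasHomomorphism K commutativeRing const const-isRingHomomorphism using (^-homo; geometric-homo)

  -- Only a bound, because at j = 0 the value 1 + 1 may vanish: the characteristic is still
  -- arbitrary. The exact degree of `lucasOdd` needs no more than this.
  lucasEven-below : ∀ b j → DegreeBelow (lucasEven (X * X) (const b) j) (suc (j ℕ.* 2))
  lucasOdd-degree : ∀ b j → HasDegree (lucasOdd (X * X) (const b) j) (j ℕ.* 2)

  X-degree : HasDegree X 1
  X-degree = 1≉0 , degreeBelow-length X

  leading-degree : ∀ b j → HasDegree (lucasEven (X * X) (const b) (suc j)) (suc j ℕ.* 2)
  leading-degree b j = hasDegree-+ (X * X * lucasOdd (X * X) (const b) j) _
    (hasDegree-* (X * X) (lucasOdd (X * X) (const b) j) (hasDegree-* X X X-degree X-degree) (lucasOdd-degree b j))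
    (degreeBelow-mono (const b * lucasEven (X * X) (const b) j) (ℕ.n≤1+n _)
      (degreeBelow-* (const b) (lucasEven (X * X) (const b) j) (degreeBelow-const b) (lucasEven-below b j)))

  lucasEven-below b zero    = degreeBelow-const _
  lucasEven-below b (suc j) = proj₂ (leading-degree b j)

  lucasOdd-degree b zero    = 1≉0 , degreeBelow-const _
  lucasOdd-degree b (suc j) = hasDegree-+ (lucasEven (X * X) (const b) (suc j)) _ (leading-degree b j)
    (degreeBelow-mono (const b * lucasOdd (X * X) (const b) j) (ℕ.n≤1+n _)
      (degreeBelow-* (const b) (lucasOdd (X * X) (const b) j) (degreeBelow-const b) (proj₂ (lucasOdd-degree b j))))

  nonconstant∤const : ∀ f {n} → HasDegree f (suc n) → ∀ a → ¬ a K.≈ K.0# → ¬ Divides f (const a)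
  nonconstant∤const f hf a a≉0 (z , a≈fz) with degree z
  ... | inj₁ z≈0 = a≉0 (coeff-≈ (trans a≈fz (trans (*-congˡ {f} z≈0) (*-zeroʳ f))) 0)
  ... | inj₂ (k , hz) with hasDegree-unique (const a) (a≉0 , degreeBelow-const a) (hasDegree-cong (sym a≈fz) (hasDegree-* f z hf hz))
  ...   | ()

  -- f is even and w is odd, so f ∣ w + a implies f ∣ - w + a and f ∣ 2 a.
  lucasOdd∤lucasProduct+const : ¬ K.1# K.+ K.1# K.≈ K.0# → ∀ b r a → ¬ a K.≈ K.0# →
    ¬ Divides (lucasOdd (X * X) (const b) (oddℕ r)) (lucasProduct X (const b) (oddℕ r) + const a)
  lucasOdd∤lucasProduct+const 2≉0 b r a a≉0 (z , w+a≈fz) =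
    nonconstant∤const f (lucasOdd-degree b (oddℕ r)) (a K.+ a) 2a≉0 (z + z′ , (begin
      const a + const a                             ≈⟨ solve 2 (λ w a → a :+ a := (w :+ a) :+ (:- w :+ a)) refl w (const a) ⟩
      (w + const a) + (- w + const a)               ≈⟨ +-cong w+a≈fz -w+a≈fz′ ⟩
      f * z + f * z′                                ≈⟨ solve 3 (λ f z z′ → f :* z :+ f :* z′ := f :* (z :+ z′)) refl f z z′ ⟩
      f * (z + z′)                                  ∎))
    where
    open Reflection K
    f = lucasOdd (X * X) (const b) (oddℕ r)
    w = lucasProduct X (const b) (oddℕ r)
    z′ = proj₁ (reflects-any z)
    -w+a≈fz′ : - w + const a ≈ f * z′
    -w+a≈fz′ = begin
      - w + const a                                          ≈⟨ +-cong (lucasProduct-neg-odd X (const b) r) refl ⟨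
      lucasProduct (- X) (const b) (oddℕ r) + const a        ≈⟨ reflects-unique w+a≈fz
        (reflects-+ (reflects-lucasProduct b (oddℕ r)) (reflects-const a))
        (reflects-* (reflects-lucasOdd b (oddℕ r)) (proj₂ (reflects-any z))) ⟩
      f * z′ ∎
    2a≉0 : ¬ a K.+ a K.≈ K.0#
    2a≉0 e = x*y≉0 2≉0 a≉0 (K.trans (K.distribʳ a K.1# K.1#)
      (K.trans (K.+-cong (K.*-identityˡ a) (K.*-identityˡ a)) e))

  -- As deg h ≤ e < deg d, the term containing dⁿ dominates all others. This keeps the homogenized
  -- factors non-constant.
  homogenize-degree : ∀ d h e → HasDegree d (suc e) → DegreeBelow h (suc e) →
    ∀ n p → HasDegree p n → HasDegree (Homogenization.homogenize K d h n p) (n ℕ.* suc e)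
  homogenize-degree d h e hd bh = go
    where
    open Homogenization K d h
    h^-below : ∀ k → DegreeBelow (h ^ k) (suc (k ℕ.* e))
    h^-below zero    = degreeBelow-const _
    h^-below (suc k) = degreeBelow-* h (h ^ k) bh (h^-below k)
    go : ∀ n p → HasDegree p n → HasDegree (homogenize n p) (n ℕ.* suc e)
    go zero    p       (p0≉0 , _) = p0≉0 , degreeBelow-const _
    go (suc n) []      (0≉0 , _)  = contradiction K.refl 0≉0
    go (suc n) (a ∷ p) (pn≉0 , b) = hasDegree-cong (+-comm (d * homogenize n p) (const a * h ^ suc n))
      (hasDegree-+ (d * homogenize n p) (const a * h ^ suc n)
        (hasDegree-* d (homogenize n p) hd (go n p (pn≉0 , degreeBelow-tail b)))
        (degreeBelow-mono (const a * h ^ suc n) (s≤s (ℕ.+-monoʳ-≤ e (ℕ.*-monoʳ-≤ n (ℕ.n≤1+n e))))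
          (degreeBelow-* (const a) (h ^ suc n) (degreeBelow-const a) (h^-below (suc n)))))

  module _ (r : ℕ) (p-prime : Prime (oddℕ (oddℕ r))) (a a⁻¹ : K.Carrier) (aa⁻¹≈1 : a K.* a⁻¹ K.≈ K.1#)
           (a≈p : a K.≈ U.geometric (oddℕ r ℕ.+ oddℕ r) K.1#) where
    private
      m = oddℕ r
      -- Half of m² + 1 = 4r² + 4r + 2, for m = 2r + 1.
      e = suc ((r ℕ.* r ℕ.+ r) ℕ.+ (r ℕ.* r ℕ.+ r))
      f = lucasOdd (X * X) (const (K.- a)) m
      w = lucasProduct X (const (K.- a)) m
      C = a U.^ e

    C≉0 : ¬ C K.≈ K.0#
    C≉0 = a^≉0 e
      where
      a≉0 : ¬ a K.≈ K.0#
      a≉0 a≈0 = 1≉0 (K.trans (K.sym aa⁻¹≈1) (K.trans (K.*-congʳ a≈0) (K.zeroˡ a⁻¹)))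
      a^≉0 : ∀ k → ¬ a U.^ k K.≈ K.0#
      a^≉0 zero    = 1≉0
      a^≉0 (suc k) = x*y≉0 a≉0 (a^≉0 k)

    -C≉0 : ¬ K.- C K.≈ K.0#
    -C≉0 -C≈0 = C≉0 (K.trans (K.sym (K.+-identityʳ C)) (K.trans (K.+-congˡ (K.sym -C≈0)) (K.-‿inverseʳ C)))

    exponent : suc (m ℕ.* m) ≡ e ℕ.+ e
    exponent = solve-ℕ 1 (λ r → con 1 :+′ (con 1 :+′ (r :+′ r)) :*′ (con 1 :+′ (r :+′ r))
      :=′ (con 1 :+′ ((r :*′ r :+′ r) :+′ (r :*′ r :+′ r))) :+′ (con 1 :+′ ((r :*′ r :+′ r) :+′ (r :*′ r :+′ r)))) ≡.refl r
      where open Data.Nat.Solver.+-*-Solver using (con) renaming (solve to solve-ℕ; _:+_ to _:+′_; _:*_ to _:*′_; _:=_ to _:=′_)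

    lucasOdd∣product : Divides f ((w + const (K.- C)) * (w + const C))
    lucasOdd∣product = LucasDivisibility.lucasOdd∣[lucasProduct-C][lucasProduct+C] commutativeRing
      X (const a) (const a⁻¹) m e (const C)
      (trans (sym (const-homo-* a a⁻¹)) (const-cong aa⁻¹≈1)) p-prime
      (trans (const-cong a≈p) (geometric-homo (m ℕ.+ m) K.1#)) exponent (^-homo a e)

    lucasOdd-reducible : ¬ K.1# K.+ K.1# K.≈ K.0# → ∀ d h k → HasDegree d (suc k) → DegreeBelow h (suc k) →
      Reducible (lucasOdd (d * d) (h ^ 2 * const (K.- a)) m)
    lucasOdd-reducible 2≉0 d h k hd bh =
      let (p , q , i , j , hp , hq , f≈pq) = zero-divisor⇒factorization f (lucasOdd-degree (K.- a) m)
            (w + const (K.- C)) (w + const C) lucasOdd∣product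
            (lucasOdd∤lucasProduct+const 2≉0 (K.- a) r (K.- C) -C≉0)
            (lucasOdd∤lucasProduct+const 2≉0 (K.- a) r C C≉0)
          -- The degrees of p and q must add up to 2m, the weight at which f homogenizes to V_m(d,
          -- h), for the homogenization of p q to split.
          degree-f : m ℕ.* 2 ≡ suc i ℕ.+ suc j
          degree-f = hasDegree-unique f (lucasOdd-degree (K.- a) m) (hasDegree-cong (sym f≈pq) (hasDegree-* p q hp hq))
      in homogenize (suc i) p , homogenize (suc j) q ,
         (suc i ℕ.* suc k , homogenize-degree d h k hd bh (suc i) p hp , s≤s z≤n) ,
         (suc j ℕ.* suc k , homogenize-degree d h k hd bh (suc j) q hq , s≤s z≤n) ,
         (begin
           lucasOdd (d * d) (h ^ 2 * const (K.- a)) m    ≈⟨ Homogenizes.value (homogenizes-lucasOdd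
                                                              (homogenizes-* homogenizes-X homogenizes-X)
                                                              (homogenizes-raise 2 (homogenizes-const (K.- a))) m) ⟨
           homogenize (m ℕ.* 2) f                        ≡⟨ ≡.cong (λ n → homogenize n f) degree-f ⟩
           homogenize (suc i ℕ.+ suc j) f                ≈⟨ homogenize-cong (suc i ℕ.+ suc j) f≈pq ⟩
           homogenize (suc i ℕ.+ suc j) (p * q)          ≈⟨ homogenize-* (suc i) (suc j) p q (proj₂ hp) (proj₂ hq) ⟩
           homogenize (suc i) p * homogenize (suc j) q   ∎)
      where open Homogenization K d h

-- The passage from integer to rational coefficients.

ι : ℤ → ℚ
ι i = i ℚ./ 1

coprime-1 : ∀ n → Coprime n 1
coprime-1 n = Coprime.sym (Coprime.1-coprimeTo n)

-- `i / 1` is normalized through a gcd and does not reduce for a variable i; the constructor form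
-- lets sums, products and numerators compute.
ι≡mkℚ : ∀ i → ι i ≡ mkℚ i 0 (coprime-1 ℤ.∣ i ∣)
ι≡mkℚ i = ℚ.↥p/↧p≡p (mkℚ i 0 (coprime-1 ℤ.∣ i ∣))

ι-homo-+ : ∀ i j → ι (i ℤ.+ j) ≡ ι i ℚ.+ ι j
ι-homo-+ i j = ≡.sym (≡.trans (≡.cong₂ ℚ._+_ (ι≡mkℚ i) (ι≡mkℚ j))
  (≡.cong₂ (λ x y → ι (x ℤ.+ y)) (ℤ.*-identityʳ i) (ℤ.*-identityʳ j)))

ι-homo-* : ∀ i j → ι (i ℤ.* j) ≡ ι i ℚ.* ι j
ι-homo-* i j = ≡.sym (≡.cong₂ ℚ._*_ (ι≡mkℚ i) (ι≡mkℚ j))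

ι-neg : ∀ n → ι (ℤ.- (+ n)) ≡ ℚ.- ι (+ n)
ι-neg zero    = ≡.refl
ι-neg (suc n) = ≡.trans (ι≡mkℚ -[1+ n ]) (≡.cong ℚ.-_ (≡.sym (ι≡mkℚ (+ suc n))))

ι-injective : ∀ {i j} → ι i ≡ ι j → i ≡ j
ι-injective {i} {j} e = ≡.cong ℚ.↥_ (≡.trans (≡.sym (ι≡mkℚ i)) (≡.trans e (ι≡mkℚ j)))

ℚ-inverse : ∀ x → x ≡ ℚ.0ℚ ⊎ ∃ λ y → x ℚ.* y ≡ ℚ.1ℚ
ℚ-inverse x with x ℚ.≟ ℚ.0ℚ
... | yes x≡0 = inj₁ x≡0
... | no  x≢0 = let instance x-nonZero = ℚ.≢-nonZero x≢0 in inj₂ (ℚ.1/ x , ℚ.*-inverseʳ x)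

ℚ-isField : IsDecidableField ℚ.+-*-commutativeRing
ℚ-isField = record { inverse = ℚ-inverse ; 1≉0 = ℚ.1≢0 }

open PolynomialRing ℚ.+-*-commutativeRing
open Degree ℚ.+-*-commutativeRing
open FieldPolynomials ℚ.+-*-commutativeRing ℚ-isField
open CommutativeRing commutativeRing using (refl; sym; trans; reflexive; setoid; *-congˡ; *-congʳ)

coeff-toℚ : ∀ p n → coeff (toℚ[x] p) n ≡ ι (ℤ[x].coeff p n)
coeff-toℚ []      n       = ≡.refl
coeff-toℚ (a ∷ p) zero    = ≡.refl
coeff-toℚ (a ∷ p) (suc n) = coeff-toℚ p n

toℚ-cong : ∀ {p q} → p ℤ[x].≈ q → toℚ[x] p ≈ toℚ[x] q
toℚ-cong {p} {q} p≈q = mk≈ λ n → ≡.trans (coeff-toℚ p n)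
  (≡.trans (≡.cong ι (ℤ[x]._≈_.coeff-≈ p≈q n)) (≡.sym (coeff-toℚ q n)))

toℚ-+ : ∀ p q → toℚ[x] (p ℤ[x].+ q) ≡ toℚ[x] p + toℚ[x] q
toℚ-+ []      q       = ≡.refl
toℚ-+ (a ∷ p) []      = ≡.refl
toℚ-+ (a ∷ p) (b ∷ q) = ≡.cong₂ _∷_ (ι-homo-+ a b) (toℚ-+ p q)

toℚ-· : ∀ a p → toℚ[x] (a ℤ[x].· p) ≡ ι a · toℚ[x] p
toℚ-· a []      = ≡.refl
toℚ-· a (b ∷ p) = ≡.cong₂ _∷_ (ι-homo-* a b) (toℚ-· a p)

toℚ-* : ∀ p q → toℚ[x] (p ℤ[x].* q) ≡ toℚ[x] p * toℚ[x] q
toℚ-* []      q = ≡.refl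
toℚ-* (a ∷ p) q = ≡.trans (toℚ-+ (a ℤ[x].· q) (+ 0 ∷ (p ℤ[x].* q)))
  (≡.cong₂ _+_ (toℚ-· a q) (≡.cong (ℚ.0ℚ ∷_) (toℚ-* p q)))

toℚ-hasDegree : ∀ p {n} → ℤ[x].HasDegree p n → HasDegree (toℚ[x] p) n
toℚ-hasDegree p {n} (pn≢0 , b) =
  (λ e → pn≢0 (ι-injective (≡.trans (≡.sym (coeff-toℚ p n)) e))) ,
  (λ m n<m → ≡.trans (coeff-toℚ p m) (≡.cong ι (b m n<m)))

module ℚUnits = RootsOfUnity ℚ.+-*-commutativeRing

-- Identifies the rational number q with the sum of q ones, the form in which the prime enters the
-- cyclotomic argument.
ι-suc≡geometric : ∀ k → ι (+ suc k) ≡ ℚUnits.geometric k ℚ.1ℚ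
ι-suc≡geometric zero    = ≡.refl
ι-suc≡geometric (suc k) = ≡.trans (ι-homo-+ (+ 1) (+ suc k))
  (≡.cong (ℚ.1ℚ ℚ.+_) (≡.trans (ι-suc≡geometric k) (≡.sym (ℚ.*-identityˡ _))))

ι-suc-invertible : ∀ k → ∃ λ y → ι (+ suc k) ℚ.* y ≡ ℚ.1ℚ
ι-suc-invertible k with ℚ-inverse (ι (+ suc k))
... | inj₂ inv = inv
... | inj₁ e with ι-injective {+ suc k} {+ 0} e
...   | ()

-- Lucas-type sequences in terms of `lucasEven` and `lucasOdd`.

module LucasTypeSequence (L : LucasType) where
  open LucasType L
  open IntegerSolver commutativeRing
  open Lucas commutativeRing
  open Relation.Binary.Reasoning.Setoid setoid

  d̂ ĝ p̂₁ α̂ : Poly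
  d̂ = toℚ[x] d
  ĝ = toℚ[x] g
  p̂₁ = toℚ[x] p₁
  α̂ = const (ι α)

  d̂≈α̂p̂₁ : d̂ ≈ α̂ * p̂₁
  d̂≈α̂p̂₁ = trans (reflexive (toℚ-· α p₁)) (sym (const-* (ι α) p̂₁))

  ℒ-recurrence : ∀ n → toℚ[x] (ℒ (suc (suc n))) ≈ d̂ * toℚ[x] (ℒ (suc n)) + ĝ * toℚ[x] (ℒ n)
  ℒ-recurrence n = reflexive (≡.trans (toℚ-+ (d ℤ[x].* ℒ (suc n)) (g ℤ[x].* ℒ n))
    (≡.cong₂ _+_ (toℚ-* d (ℒ (suc n))) (toℚ-* g (ℒ n))))

  -- Joint induction. The factor α normalizes the start, as α p₀ = 2 = `lucasEven` at 0, and d = α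
  -- p₁ then trades α at even indices for p₁ at odd ones.
  ℒ-even : ∀ j → α̂ * toℚ[x] (ℒ (j ℕ.* 2)) ≈ lucasEven (d̂ * d̂) ĝ j
  ℒ-odd  : ∀ j → toℚ[x] (ℒ (suc (j ℕ.* 2))) ≈ p̂₁ * lucasOdd (d̂ * d̂) ĝ j
  ℒ-even zero    = begin
    const (ι α) * const (ι p₀)      ≈⟨ const-homo-* (ι α) (ι p₀) ⟨
    const (ι α ℚ.* ι p₀)            ≡⟨ ≡.cong const (≡.trans (≡.sym (ι-homo-* α p₀)) (≡.cong ι α-def)) ⟩
    1# + 1#                         ∎
  ℒ-even (suc j) = begin
    α̂ * toℚ[x] (ℒ (suc (suc (j ℕ.* 2))))
      ≈⟨ *-congˡ {α̂} (ℒ-recurrence (j ℕ.* 2)) ⟩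
    α̂ * (d̂ * toℚ[x] (ℒ (suc (j ℕ.* 2))) + ĝ * toℚ[x] (ℒ (j ℕ.* 2)))
      ≈⟨ *-congˡ {α̂} (+-cong (*-congˡ {d̂} (ℒ-odd j)) refl) ⟩
    α̂ * (d̂ * (p̂₁ * v) + ĝ * toℚ[x] (ℒ (j ℕ.* 2)))
      ≈⟨ solve 6 (λ α d p v g l → α :* (d :* (p :* v) :+ g :* l) := d :* (α :* p) :* v :+ g :* (α :* l))
           refl α̂ d̂ p̂₁ v ĝ (toℚ[x] (ℒ (j ℕ.* 2))) ⟩
    d̂ * (α̂ * p̂₁) * v + ĝ * (α̂ * toℚ[x] (ℒ (j ℕ.* 2)))
      ≈⟨ +-cong (*-congʳ {v} (*-congˡ {d̂} (sym d̂≈α̂p̂₁))) (*-congˡ {ĝ} (ℒ-even j)) ⟩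
    lucasEven (d̂ * d̂) ĝ (suc j) ∎
    where v = lucasOdd (d̂ * d̂) ĝ j
  ℒ-odd zero    = sym (CommutativeRing.*-identityʳ commutativeRing p̂₁)
  ℒ-odd (suc j) = begin
    toℚ[x] (ℒ (suc (suc (suc (j ℕ.* 2)))))
      ≈⟨ ℒ-recurrence (suc (j ℕ.* 2)) ⟩
    d̂ * l + ĝ * toℚ[x] (ℒ (suc (j ℕ.* 2)))
      ≈⟨ +-cong (*-congʳ {l} d̂≈α̂p̂₁) (*-congˡ {ĝ} (ℒ-odd j)) ⟩
    α̂ * p̂₁ * l + ĝ * (p̂₁ * v)
      ≈⟨ solve 5 (λ α p l g v → α :* p :* l :+ g :* (p :* v) := p :* (α :* l :+ g :* v)) refl α̂ p̂₁ l ĝ v ⟩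
    p̂₁ * (α̂ * l + ĝ * v)
      ≈⟨ *-congˡ {p̂₁} (+-cong (ℒ-even (suc j)) refl) ⟩
    p̂₁ * lucasOdd (d̂ * d̂) ĝ (suc j) ∎
    where
    l = toℚ[x] (ℒ (suc (suc (j ℕ.* 2))))
    v = lucasOdd (d̂ * d̂) ĝ j

  open RootsOfUnity commutativeRing using (_^_)

  ĝ≈-qĥ² : ∀ q h → g ℤ[x].≈ (ℤ.- (+ q)) ℤ[x].· (h ℤ[x].* h) →
    ĝ ≈ toℚ[x] h ^ 2 * const (ℚ.- ι (+ q))
  ĝ≈-qĥ² q h g≈-qh² = begin
    ĝ                                             ≈⟨ toℚ-cong g≈-qh² ⟩
    toℚ[x] ((ℤ.- (+ q)) ℤ[x].· (h ℤ[x].* h))      ≡⟨ ≡.trans (toℚ-· (ℤ.- (+ q)) (h ℤ[x].* h)) (≡.cong₂ _·_ (ι-neg q) (toℚ-* h h)) ⟩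
    (ℚ.- ι (+ q)) · (ĥ * ĥ)                       ≈⟨ const-* (ℚ.- ι (+ q)) (ĥ * ĥ) ⟨
    const (ℚ.- ι (+ q)) * (ĥ * ĥ)                 ≈⟨ solve 2 (λ c h → c :* (h :* h) := h :* (h :* :1) :* c) refl (const (ℚ.- ι (+ q))) ĥ ⟩
    ĥ ^ 2 * const (ℚ.- ι (+ q))                   ∎
    where ĥ = toℚ[x] h

  -- From g = b h² follows deg h ≤ deg g < deg d. If h or b were zero, g would vanish, although it
  -- has a degree.
  h-degree : ∀ b h → ĝ ≈ h ^ 2 * const b → ∃ λ k → HasDegree d̂ (suc k) × DegreeBelow h (suc k)
  h-degree b h ĝ≈h²b with degree h | degree (const b) | g-deg<-d
  ... | inj₁ h≈0 | _ | m , n , hg , hd , m<n = contradiction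
    (trans ĝ≈h²b (*-congʳ {const b} (≈0-* (h * 1#) h≈0))) (hasDegree⇒≉0 ĝ (toℚ-hasDegree g hg))
  ... | _ | inj₁ b≈0 | m , n , hg , hd , m<n = contradiction
    (trans ĝ≈h²b (trans (*-congˡ {h ^ 2} b≈0) (*-zeroʳ (h ^ 2)))) (hasDegree⇒≉0 ĝ (toℚ-hasDegree g hg))
  ... | inj₂ (k , hh) | inj₂ (l , hb) | m , suc n , hg , hd , s≤s m≤n = n , toℚ-hasDegree d hd ,
    degreeBelow-mono h (s≤s (ℕ.≤-trans k≤m m≤n)) (proj₂ hh)
    where
    m≡ : m ≡ (k ℕ.+ (k ℕ.+ 0)) ℕ.+ l
    m≡ = hasDegree-unique ĝ (toℚ-hasDegree g hg) (hasDegree-cong (sym ĝ≈h²b)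
      (hasDegree-* (h ^ 2) (const b) (hasDegree-* h (h * 1#) hh (hasDegree-* h 1# hh (ℚ.1≢0 , degreeBelow-const ℚ.1ℚ))) hb))
    k≤m : k ℕ.≤ m
    k≤m = ≡.subst (k ℕ.≤_) (≡.sym m≡) (ℕ.≤-trans (ℕ.m≤m+n k (k ℕ.+ 0)) (ℕ.m≤m+n (k ℕ.+ (k ℕ.+ 0)) l))

-- The case q = 2m + 1 with m = 2r + 1.

≡3mod4⇒odd-odd : ∀ q → q % 4 ≡ 3 → ∃ λ r → q ≡ oddℕ (oddℕ r)
≡3mod4⇒odd-odd q q%4≡3 = q / 4 , ≡.trans (m≡m%n+[m/n]*n q 4) (≡.trans (≡.cong (ℕ._+ q / 4 ℕ.* 4) q%4≡3)
  (solve 1 (λ r → con 3 :+ r :* con 4 := con 1 :+ ((con 1 :+ (r :+ r)) :+ (con 1 :+ (r :+ r)))) ≡.refl (q / 4)))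
  where open Data.Nat.Solver.+-*-Solver

proposition4p12 : (L : LucasType) (let open LucasType L) (q : ℕ) → Prime q → q % 4 ≡ 3 →
    (h : ℤ[x].Poly) → g ℤ[x].≈ (ℤ.- (+ q)) ℤ[x].· (h ℤ[x].* h) →
    ∃ λ (k : ℚ[x].Poly) → (toℚ[x] (ℒ q) ℚ[x].≈ toℚ[x] p₁ ℚ[x].* k) × ℚ[x].Reducible k
proposition4p12 L q q-prime q%4≡3 h g≈-qh² with ≡3mod4⇒odd-odd q q%4≡3
... | r , ≡.refl =
  -- The quotient of ℒ_q by p₁, given explicitly.
  lucasOdd (d̂ * d̂) ĝ m , ℒ-q , reducible
  where
  open LucasTypeSequence L
  open Lucas commutativeRing
  open LucasReducibility ℚ.+-*-commutativeRing ℚ-isField using (lucasOdd-reducible)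
  m = oddℕ r
  ĝ≈ = ĝ≈-qĥ² q h g≈-qh²
  ℒ-q : toℚ[x] (LucasType.ℒ L q) ≈ p̂₁ * lucasOdd (d̂ * d̂) ĝ m
  ℒ-q = ≡.subst (λ n → toℚ[x] (LucasType.ℒ L (suc n)) ≈ p̂₁ * lucasOdd (d̂ * d̂) ĝ m)
    -- Reconciles the index `m * 2` of `ℒ-odd` with the `m + m` in `oddℕ m`.
    (≡.trans (ℕ.*-comm m 2) (≡.cong (m ℕ.+_) (ℕ.+-identityʳ m))) (ℒ-odd m)
  reducible : Reducible (lucasOdd (d̂ * d̂) ĝ m)
  reducible =
    let (e , hd , bh) = h-degree (ℚ.- ι (+ q)) (toℚ[x] h) ĝ≈
        (q⁻¹ , qq⁻¹≡1) = ι-suc-invertible (m ℕ.+ m)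
        (u , v , hu , hv , ≈uv) = lucasOdd-reducible r q-prime (ι (+ q)) q⁻¹ qq⁻¹≡1
          -- The absurd pattern shows 1 + 1 ≠ 0: both sides are closed rationals that evaluate
          -- differently.
          (ι-suc≡geometric (m ℕ.+ m)) (λ ()) d̂ (toℚ[x] h) e hd bh
    in u , v , hu , hv , trans (lucasOdd-cong refl ĝ≈ m) ≈uv
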